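{- Let $G$ and $H$ be connected graphs. (i) If $G$ is a tree and $\frac{|V(H)|}{\lambda(H)}\le |V(G)|$, then $\mathrm{sn}(G\square H)=\mathrm{gon}(G\square H)=|V(H)|$. (ii) If $\mathrm{gon}(H)=\lambda(H)$ and $|V(G)|\le\frac{|V(H)|}{\lambda(H)}$, then $\mathrm{sn}(G\square H)=\mathrm{gon}(G\square H)=|V(G)|\cdot\lambda(H)$.
   Context: Graphs are finite, multiple edges allowed, no loops; $\lambda$ is edge-connectivity (edges counted with multiplicity). $G\square H$ is the Cartesian product (vertex set $V(G)\times V(H)$; $(u_1,v_1),(u_2,v_2)$ joined by $e$ edges iff $u_1=u_2$ and $v_1,v_2$ joined by $e$ edges in $H$, or $v_1=v_2$ and $u_1,u_2$ joined by $e$ edges in $G$). Scramble number $\mathrm{sn}$: a scramble is a finite collection of nonempty vertex sets (eggs) each inducing a connected subgraph; its order is $\min(h,e)$ where $h$ is the minimum size of a vertex set meeting every egg and $e$ is the minimum of $|E(A,A^C)|$ over $A\subseteq V$ containing some egg whose complement contains some egg ($+\infty$ if none); $\mathrm{sn}$ is the maximum order. Gonality: a divisor is an integer combination of vertices; firing a vertex $w$ removes $\mathrm{val}(w)$ chips from $w$ and gives each other vertex one chip per edge to $w$; divisors are equivalent if related by firings; $D$ has positive rank if $D-(v)$ is equivalent to an effective divisor for every vertex $v$; $\mathrm{gon}$ is the minimum degree of a positive rank divisor. -}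

module Defs where

open import Data.Nat using (ℕ; zero; suc; _+_; _*_; _∸_; _≤_; _<_; _<ᵇ_)
open import Data.Integer as ℤ using (ℤ; +_; 0ℤ; 1ℤ)
open import Data.Fin using (Fin; zero; suc; toℕ; remQuot; _≟_)
open import Data.Fin.Subset using (Subset; _∈_; _∉_; _⊆_; ∁; ∣_∣; Nonempty)
open import Data.Vec using (lookup)
open import Data.Bool using (Bool; true; false; if_then_else_; _∧_; not)
open import Data.List using (List)
open import Data.List.Membership.Propositional using () renaming (_∈_ to _∈ₗ_)
open import Data.Product using (Σ; ∃; _×_; _,_; proj₁; proj₂)
open import Relation.Nullary.Decidable using (⌊_⌋)
open import Relation.Binary.PropositionalEquality using (_≡_)
open import Relation.Binary.Construct.Closure.Equivalence using (EqClosure)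

-- Finite multigraphs: vertex set Fin n, mult u v = number of edges u–v.

record Graph : Set where
  field
    n    : ℕ
    mult : Fin n → Fin n → ℕ
open Graph public

IsGraph : Graph → Set
IsGraph G = (∀ u v → mult G u v ≡ mult G v u) × (∀ u → mult G u u ≡ 0)

sumℕ : ∀ {n} → (Fin n → ℕ) → ℕ
sumℕ {zero}  f = 0
sumℕ {suc n} f = f zero + sumℕ (λ i → f (suc i))

sumℤ : ∀ {n} → (Fin n → ℤ) → ℤ
sumℤ {zero}  f = 0ℤ
sumℤ {suc n} f = f zero ℤ.+ sumℤ (λ i → f (suc i))

val : (G : Graph) → Fin (n G) → ℕ
val G w = sumℕ (λ v → mult G w v)

numEdges : Graph → ℕ
numEdges G = sumℕ (λ u → sumℕ (λ v → if toℕ u <ᵇ toℕ v then mult G u v else 0))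

data ReachIn (G : Graph) (S : Subset (n G)) : Fin (n G) → Fin (n G) → Set where
  here : ∀ {u} → u ∈ S → ReachIn G S u u
  step : ∀ {u w v} → u ∈ S → 0 < mult G u w → ReachIn G S w v → ReachIn G S u v

InducesConnected : (G : Graph) → Subset (n G) → Set
InducesConnected G S = Nonempty S × (∀ u v → u ∈ S → v ∈ S → ReachIn G S u v)

Connected : Graph → Set
Connected G = (0 < n G) × (∀ u v → ReachIn G (Data.Fin.Subset.⊤) u v)
  where import Data.Fin.Subset

IsTree : Graph → Set
IsTree G = Connected G × numEdges G ≡ n G ∸ 1

cutSize : (G : Graph) → Subset (n G) → ℕ
cutSize G A = sumℕ (λ u → sumℕ (λ v →
  if lookup A u ∧ not (lookup A v) then mult G u v else 0))

-- λ(G) = k  (no such k exists when G has a single vertex, i.e. λ = +∞)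
IsEdgeConnectivity : Graph → ℕ → Set
IsEdgeConnectivity G k =
  (Σ (Subset (n G)) λ A → Nonempty A × Nonempty (∁ A) × cutSize G A ≡ k)
  × (∀ A → Nonempty A → Nonempty (∁ A) → k ≤ cutSize G A)

_□_ : Graph → Graph → Graph
G □ H = record { n = n G * n H ; mult = m }
  where
  m : Fin (n G * n H) → Fin (n G * n H) → ℕ
  m x y with remQuot (n H) x | remQuot (n H) y
  ... | u₁ , v₁ | u₂ , v₂ =
    (if ⌊ u₁ ≟ u₂ ⌋ then mult H v₁ v₂ else 0)
    + (if ⌊ v₁ ≟ v₂ ⌋ then mult G u₁ u₂ else 0)

Scramble : Graph → Set
Scramble G = Σ (List (Subset (n G))) λ eggs → ∀ E → E ∈ₗ eggs → InducesConnected G E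

eggsOf : ∀ {G} → Scramble G → List (Subset (n G))
eggsOf = proj₁

Hitting : ∀ {G} → Scramble G → Subset (n G) → Set
Hitting S T = ∀ E → E ∈ₗ eggsOf S → ∃ λ v → v ∈ E × v ∈ T

Separating : ∀ {G} → Scramble G → Subset (n G) → Set
Separating S A = (∃ λ E → E ∈ₗ eggsOf S × E ⊆ A) × (∃ λ E → E ∈ₗ eggsOf S × E ⊆ ∁ A)

-- ‖S‖ ≥ k, where ‖S‖ = min(h(S), e(S))  (e(S) = +∞ if nothing separates)
OrderAtLeast : ∀ {G} → Scramble G → ℕ → Set
OrderAtLeast {G} S k =
  (∀ T → Hitting S T → k ≤ ∣ T ∣) × (∀ A → Separating S A → k ≤ cutSize G A)

IsScrambleNumber : (G : Graph) → ℕ → Set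
IsScrambleNumber G s =
  (Σ (Scramble G) λ S → OrderAtLeast S s) × (∀ (S : Scramble G) k → OrderAtLeast S k → k ≤ s)

Divisor : Graph → Set
Divisor G = Fin (n G) → ℤ

deg : ∀ {G} → Divisor G → ℤ
deg D = sumℤ D

fire : (G : Graph) → Fin (n G) → Divisor G → Divisor G
fire G w D v = if ⌊ v ≟ w ⌋ then D v ℤ.- + val G w else D v ℤ.+ + mult G v w

Fires : (G : Graph) → Divisor G → Divisor G → Set
Fires G D D' = ∃ λ w → ∀ v → D' v ≡ fire G w D v

LinEquiv : (G : Graph) → Divisor G → Divisor G → Set
LinEquiv G D D' = EqClosure (Fires G) D D'

Effective : ∀ {G} → Divisor G → Set
Effective D = ∀ v → 0ℤ ℤ.≤ D v

minusPoint : ∀ {G} → Divisor G → Fin (n G) → Divisor G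
minusPoint D v u = if ⌊ u ≟ v ⌋ then D u ℤ.- 1ℤ else D u

PositiveRank : (G : Graph) → Divisor G → Set
PositiveRank G D = ∀ v → Σ (Divisor G) λ E → LinEquiv G (minusPoint {G} D v) E × Effective {G} E

IsGonality : (G : Graph) → ℕ → Set
IsGonality G g =
  (Σ (Divisor G) λ D → PositiveRank G D × deg {G} D ≡ + g)
  × (∀ D → PositiveRank G D → + g ℤ.≤ deg {G} D)

{-# OPTIONS --safe #-}
-- Lower bound: the scramble whose eggs are the rows G × {v} has hitting number |V(H)|, and a set
-- separating two rows cuts every column {u} × H, hence has at least |V(G)|·λ(H) boundary edges.
-- Upper bound: a positive-rank divisor of G or of H, together with its firing functions, pulls back
-- along the projections of G □ H.  The two meet because sn ≤ gon: if an effective divisor D of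
-- positive rank misses an egg E, fire D towards E along the superlevel sets of a firing function,
-- staying effective.  When E is first hit, either every egg hit before is still hit and D has
-- improved, or some egg was lost, and then one of the fired sets separates two eggs, so the degree
-- is at least the size of an egg-cut.
module Submission where

open import Defs
open import Algebra.Properties.CommutativeSemigroup using (interchange)
open import Data.Bool using (Bool; true; false; if_then_else_; not; _∧_) renaming (_≟_ to _≟ᵇ_)
open import Data.Bool.Properties using (¬-not; not-involutive)
open import Data.Fin using (Fin; zero; suc; toℕ; fromℕ<; combine; quotient; remainder; _↑ˡ_; _↑ʳ_; _≟_)
open import Data.Fin.Properties using (any?; toℕ-injective; remQuot-combine; combine-surjective; combine-injectiveˡ; combine-injectiveʳ)
open import Data.Fin.Subset using (Subset; _∈_; _⊆_; ∁; ∣_∣; Nonempty; ⊤)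
open import Data.Fin.Subset.Properties using (_∈?_; x∉p⇒x∈∁p; x∈∁p⇒x∉p; anySubset?; nonempty?)
open import Data.Integer as ℤ using (ℤ; +_; -[1+_]; 0ℤ; 1ℤ)
open import Data.Integer.Properties as ℤ using ()
open import Data.Integer.Tactic.RingSolver using (solve-∀)
open import Data.List as List using (List; []; _∷_)
open import Data.List.Membership.Propositional using (find; lose) renaming (_∈_ to _∈ₗ_)
open import Data.List.Membership.Propositional.Properties using (∈-tabulate⁺; ∈-tabulate⁻)
open import Data.List.Relation.Unary.Any as Any using (here; there)
open import Data.Nat using (ℕ; zero; suc; _+_; _*_; _∸_; _≤_; _<_; z≤n; s≤s; _<ᵇ_)
open import Data.Nat.Properties as ℕ using ()
import Data.Nat.Tactic.RingSolver as ℕ-Solver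
open import Data.Product using (Σ; ∃; ∃₂; _×_; _,_; proj₁; proj₂)
open import Data.Sum using (_⊎_; inj₁; inj₂)
open import Data.Vec using (lookup; tabulate)
open import Data.Vec.Properties using (lookup∘tabulate; tabulate∘lookup; lookup⇒[]=; []=⇒lookup)
open import Function using (_∘_)
open import Relation.Binary.Construct.Closure.ReflexiveTransitive using (ε; _◅_; _◅◅_)
open import Relation.Binary.Construct.Closure.Symmetric using (fwd; bwd)
open import Relation.Binary.Definitions using (tri<; tri≈; tri>)
open import Relation.Binary.PropositionalEquality
open import Relation.Nullary using (¬_; Dec; yes; no; contradiction; ¬?; _×-dec_)
open import Relation.Nullary.Decidable using (⌊_⌋; decidable-stable)

-- Linear equivalence is handled through the Laplacian: one integer vector `f` replaces a sequence
-- of firings, and `Movable` asks that `D - Δ f` be effective with a chip at the target. This form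
-- pulls back along a projection, because the Laplacian of a product splits over the two factors and
-- vanishes on a factor along which `f` is constant. In the tree case the divisor pulled back is a
-- single chip. That one chip can reach every vertex of a tree has to be derived from connectedness
-- and the edge count: the tree is assembled leaf by leaf and the firing function is extended along
-- with it. The numerical hypothesis of each case decides which term of the order of the row
-- scramble is the smaller one, the hitting number `n H` or the cut bound `n G * k`. If `H` is a
-- single vertex, no `k` is its edge-connectivity; then there is only one row and nothing separates.

private variable
  m k : ℕ

-- Finite sums over `Fin`

sumℕ-cong : {f g : Fin m → ℕ} → f ≗ g → sumℕ f ≡ sumℕ g
sumℕ-cong {zero}  f≗g = refl
sumℕ-cong {suc m} f≗g = cong₂ _+_ (f≗g zero) (sumℕ-cong (f≗g ∘ suc))

sumℤ-cong : {f g : Fin m → ℤ} → f ≗ g → sumℤ f ≡ sumℤ g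
sumℤ-cong {zero}  f≗g = refl
sumℤ-cong {suc m} f≗g = cong₂ ℤ._+_ (f≗g zero) (sumℤ-cong (f≗g ∘ suc))

sumℕ-const : ∀ m (c : ℕ) → sumℕ {m} (λ _ → c) ≡ m * c
sumℕ-const zero    c = refl
sumℕ-const (suc m) c = cong (_+_ c) (sumℕ-const m c)

sumℕ-zero : {f : Fin m → ℕ} → (∀ i → f i ≡ 0) → sumℕ f ≡ 0
sumℕ-zero {zero}  f≗0 = refl
sumℕ-zero {suc m} f≗0 = cong₂ _+_ (f≗0 zero) (sumℕ-zero (f≗0 ∘ suc))

sumℤ-zero : {f : Fin m → ℤ} → (∀ i → f i ≡ 0ℤ) → sumℤ f ≡ 0ℤ
sumℤ-zero {zero}  f≗0 = refl
sumℤ-zero {suc m} f≗0 = cong₂ ℤ._+_ (f≗0 zero) (sumℤ-zero (f≗0 ∘ suc))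

sumℕ-+ : (f g : Fin m → ℕ) → sumℕ (λ i → f i + g i) ≡ sumℕ f + sumℕ g
sumℕ-+ {zero}  f g = refl
sumℕ-+ {suc m} f g =
  trans (cong (_+_ (f zero + g zero)) (sumℕ-+ (f ∘ suc) (g ∘ suc))) (interchange ℕ.+-commutativeSemigroup (f zero) (g zero) _ _)

sumℤ-+ : (f g : Fin m → ℤ) → sumℤ (λ i → f i ℤ.+ g i) ≡ sumℤ f ℤ.+ sumℤ g
sumℤ-+ {zero}  f g = refl
sumℤ-+ {suc m} f g =
  trans (cong (ℤ._+_ (f zero ℤ.+ g zero)) (sumℤ-+ (f ∘ suc) (g ∘ suc))) (interchange ℤ.+-commutativeSemigroup (f zero) (g zero) _ _)

sumℕ-swap : (f : Fin m → Fin k → ℕ) →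
  sumℕ (λ i → sumℕ (f i)) ≡ sumℕ (λ j → sumℕ (λ i → f i j))
sumℕ-swap {zero}  {k} f = sym (sumℕ-zero {k} (λ _ → refl))
sumℕ-swap {suc m} {k} f =
  trans (cong (_+_ (sumℕ (f zero))) (sumℕ-swap (f ∘ suc))) (sym (sumℕ-+ (f zero) (λ j → sumℕ (λ i → f (suc i) j))))

sumℤ-swap : (f : Fin m → Fin k → ℤ) →
  sumℤ (λ i → sumℤ (f i)) ≡ sumℤ (λ j → sumℤ (λ i → f i j))
sumℤ-swap {zero}  {k} f = sym (sumℤ-zero {k} (λ _ → refl))
sumℤ-swap {suc m} {k} f =
  trans (cong (ℤ._+_ (sumℤ (f zero))) (sumℤ-swap (f ∘ suc))) (sym (sumℤ-+ (f zero) (λ j → sumℤ (λ i → f (suc i) j))))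

neg-distrib-sumℤ : (f : Fin m → ℤ) → ℤ.- sumℤ f ≡ sumℤ (λ i → ℤ.- f i)
neg-distrib-sumℤ {zero}  f = refl
neg-distrib-sumℤ {suc m} f =
  trans (ℤ.neg-distrib-+ (f zero) _) (cong (ℤ._+_ (ℤ.- f zero)) (neg-distrib-sumℤ (f ∘ suc)))

sumℕ-mono : {f g : Fin m → ℕ} → (∀ i → f i ≤ g i) → sumℕ f ≤ sumℕ g
sumℕ-mono {zero}  f≤g = z≤n
sumℕ-mono {suc m} f≤g = ℕ.+-mono-≤ (f≤g zero) (sumℕ-mono (f≤g ∘ suc))

sumℤ-mono : {f g : Fin m → ℤ} → (∀ i → f i ℤ.≤ g i) → sumℤ f ℤ.≤ sumℤ g
sumℤ-mono {zero}  f≤g = ℤ.≤-refl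
sumℤ-mono {suc m} f≤g = ℤ.+-mono-≤ (f≤g zero) (sumℤ-mono (f≤g ∘ suc))

+-sumℕ : (f : Fin m → ℕ) → + sumℕ f ≡ sumℤ (λ i → + f i)
+-sumℕ {zero}  f = refl
+-sumℕ {suc m} f = cong (ℤ._+_ (+ f zero)) (+-sumℕ (f ∘ suc))

sumℤ-const : ∀ m (c : ℕ) → sumℤ {m} (λ _ → + c) ≡ + (m * c)
sumℤ-const m c = trans (sym (+-sumℕ {m} (λ _ → c))) (cong +_ (sumℕ-const m c))

term≤sumℕ : (f : Fin m → ℕ) (i : Fin m) → f i ≤ sumℕ f
term≤sumℕ f zero    = ℕ.m≤m+n _ _
term≤sumℕ f (suc i) = ℕ.≤-trans (term≤sumℕ (f ∘ suc) i) (ℕ.m≤n+m _ _)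

sumℕ-++ : ∀ m {k} (f : Fin (m + k) → ℕ) →
  sumℕ f ≡ sumℕ (λ i → f (i ↑ˡ k)) + sumℕ (λ j → f (m ↑ʳ j))
sumℕ-++ zero    f = refl
sumℕ-++ (suc m) f = trans (cong (_+_ (f zero)) (sumℕ-++ m (f ∘ suc))) (sym (ℕ.+-assoc (f zero) _ _))

sumℤ-++ : ∀ m {k} (f : Fin (m + k) → ℤ) →
  sumℤ f ≡ sumℤ (λ i → f (i ↑ˡ k)) ℤ.+ sumℤ (λ j → f (m ↑ʳ j))
sumℤ-++ zero    f = sym (ℤ.+-identityˡ _)
sumℤ-++ (suc m) f = trans (cong (ℤ._+_ (f zero)) (sumℤ-++ m (f ∘ suc))) (sym (ℤ.+-assoc (f zero) _ _))

sumℕ-combine : ∀ m {k} (f : Fin (m * k) → ℕ) →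
  sumℕ f ≡ sumℕ {m} (λ i → sumℕ {k} (λ j → f (combine i j)))
sumℕ-combine zero        f = refl
sumℕ-combine (suc m) {k} f = trans (sumℕ-++ k f) (cong (_+_ (sumℕ (λ j → f (j ↑ˡ (m * k))))) (sumℕ-combine m (f ∘ (k ↑ʳ_))))

sumℤ-combine : ∀ m {k} (f : Fin (m * k) → ℤ) →
  sumℤ f ≡ sumℤ {m} (λ i → sumℤ {k} (λ j → f (combine i j)))
sumℤ-combine zero        f = refl
sumℤ-combine (suc m) {k} f = trans (sumℤ-++ k f) (cong (ℤ._+_ (sumℤ (λ j → f (j ↑ˡ (m * k))))) (sumℤ-combine m (f ∘ (k ↑ʳ_))))

-- Indicators and the Kronecker delta

ι : Bool → ℕ
ι b = if b then 1 else 0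

δ : Fin m → Fin m → ℕ
δ i j = ι ⌊ i ≟ j ⌋

δ-refl : (i : Fin m) → δ i i ≡ 1
δ-refl i with i ≟ i
... | yes _   = refl
... | no  i≢i = contradiction refl i≢i

δ-≢ : {i j : Fin m} → i ≢ j → δ i j ≡ 0
δ-≢ {i = i} {j} i≢j with i ≟ j
... | yes i≡j = contradiction i≡j i≢j
... | no  _   = refl

δ-sym : (i j : Fin m) → δ i j ≡ δ j i
δ-sym i j with i ≟ j
... | yes refl = sym (δ-refl i)
... | no  i≢j  = sym (δ-≢ (i≢j ∘ sym))

δ-suc : (i j : Fin m) → δ (suc i) (suc j) ≡ δ i j
δ-suc i j with i ≟ j
... | yes _ = refl
... | no  _ = refl

sumℕ-δ : (i : Fin m) (g : Fin m → ℕ) → sumℕ (λ j → δ i j * g j) ≡ g i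
sumℕ-δ {suc m} zero g = trans (cong₂ _+_ (ℕ.*-identityˡ (g zero)) (sumℕ-zero {m} (λ _ → refl))) (ℕ.+-identityʳ _)
sumℕ-δ (suc i) g = trans (sumℕ-cong (λ j → cong (_* g (suc j)) (δ-suc i j))) (sumℕ-δ i (g ∘ suc))

sumℤ-δ : (i : Fin m) (g : Fin m → ℤ) → sumℤ (λ j → + δ i j ℤ.* g j) ≡ g i
sumℤ-δ zero    g = trans (cong₂ ℤ._+_ (ℤ.*-identityˡ (g zero)) (sumℤ-zero (λ j → ℤ.*-zeroˡ (g (suc j))))) (ℤ.+-identityʳ _)
sumℤ-δ (suc i) g = trans (cong₂ ℤ._+_ (ℤ.*-zeroˡ (g zero)) (trans (sumℤ-cong (λ j → cong (λ d → + d ℤ.* g (suc j)) (δ-suc i j))) (sumℤ-δ i (g ∘ suc)))) (ℤ.+-identityˡ _)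

sumℕ-δ-1 : (i : Fin m) → sumℕ (δ i) ≡ 1
sumℕ-δ-1 i = trans (sumℕ-cong (λ j → sym (ℕ.*-identityʳ (δ i j)))) (sumℕ-δ i (λ _ → 1))

-- Graph Laplacians and chip firing

-- The Laplacian is defined for an arbitrary matrix rather than a graph, because the tree argument
-- applies it to `Within a`, which need not be symmetric.
Δ : (Fin m → Fin m → ℕ) → (Fin m → ℤ) → Fin m → ℤ
Δ M f u = sumℤ λ v → + M u v ℤ.* (f u ℤ.- f v)

module _ (M : Fin m → Fin m → ℕ) where

  Δ-cong-diff : ∀ f g u → (∀ v → f u ℤ.- f v ≡ g u ℤ.- g v) → Δ M f u ≡ Δ M g u
  Δ-cong-diff f g u eq = sumℤ-cong (λ v → cong (ℤ._*_ (+ M u v)) (eq v))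

  Δ-cong : ∀ {f g} → f ≗ g → ∀ u → Δ M f u ≡ Δ M g u
  Δ-cong {f} {g} f≗g u = Δ-cong-diff f g u (λ v → cong₂ ℤ._-_ (f≗g u) (f≗g v))

  Δ-mono : ∀ {f g} u → (∀ v → f u ℤ.- f v ℤ.≤ g u ℤ.- g v) → Δ M f u ℤ.≤ Δ M g u
  Δ-mono u le = sumℤ-mono (λ v → ℤ.*-monoˡ-≤-nonNeg (+ M u v) (le v))

  Δ-zero : ∀ u → Δ M (λ _ → 0ℤ) u ≡ 0ℤ
  Δ-zero u = sumℤ-zero (λ v → ℤ.*-zeroʳ (+ M u v))

  Δ-+ : ∀ f g u → Δ M (λ v → f v ℤ.+ g v) u ≡ Δ M f u ℤ.+ Δ M g u
  Δ-+ f g u = trans (sumℤ-cong (λ v → distrib (+ M u v) (f u) (g u) (f v) (g v))) (sumℤ-+ (λ v → + M u v ℤ.* (f u ℤ.- f v)) (λ v → + M u v ℤ.* (g u ℤ.- g v)))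
    where
    distrib : ∀ c a b x y → c ℤ.* ((a ℤ.+ b) ℤ.- (x ℤ.+ y)) ≡ c ℤ.* (a ℤ.- x) ℤ.+ c ℤ.* (b ℤ.- y)
    distrib = solve-∀

  Δ-neg : ∀ f u → Δ M (λ v → ℤ.- f v) u ≡ ℤ.- Δ M f u
  Δ-neg f u = trans (sumℤ-cong (λ v → neg (+ M u v) (f u) (f v))) (sym (neg-distrib-sumℤ (λ v → + M u v ℤ.* (f u ℤ.- f v))))
    where
    neg : ∀ c a x → c ℤ.* (ℤ.- a ℤ.- ℤ.- x) ≡ ℤ.- (c ℤ.* (a ℤ.- x))
    neg = solve-∀

  -- Exchanging the two summation indices reverses the sign of every term, so the total equals its
  -- own negative.
  Δ-sum : (∀ u v → M u v ≡ M v u) → ∀ f → sumℤ (Δ M f) ≡ 0ℤ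
  Δ-sum M-sym f = x≡-x⇒x≡0 _ (begin
    sumℤ (λ u → sumℤ (λ v → + M u v ℤ.* (f u ℤ.- f v)))         ≡⟨ sumℤ-swap (λ u v → + M u v ℤ.* (f u ℤ.- f v)) ⟩
    sumℤ (λ v → sumℤ (λ u → + M u v ℤ.* (f u ℤ.- f v)))         ≡⟨ sumℤ-cong (λ v → sumℤ-cong (λ u → flip u v)) ⟩
    sumℤ (λ v → sumℤ (λ u → ℤ.- (+ M v u ℤ.* (f v ℤ.- f u))))   ≡⟨ sumℤ-cong (λ v → neg-distrib-sumℤ (λ u → + M v u ℤ.* (f v ℤ.- f u))) ⟨
    sumℤ (λ v → ℤ.- Δ M f v)                                     ≡⟨ neg-distrib-sumℤ (Δ M f) ⟨
    ℤ.- sumℤ (Δ M f)                                             ∎)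
    where
    open ≡-Reasoning
    antisym : ∀ c a x → c ℤ.* (a ℤ.- x) ≡ ℤ.- (c ℤ.* (x ℤ.- a))
    antisym = solve-∀
    flip : ∀ u v → + M u v ℤ.* (f u ℤ.- f v) ≡ ℤ.- (+ M v u ℤ.* (f v ℤ.- f u))
    flip u v = trans (antisym (+ M u v) (f u) (f v)) (cong (λ c → ℤ.- (+ c ℤ.* (f v ℤ.- f u))) (M-sym u v))
    x≡-x⇒x≡0 : ∀ x → x ≡ ℤ.- x → x ≡ 0ℤ
    x≡-x⇒x≡0 (+ zero) _ = refl

-- Only differences of `f` enter `Δ`, so a constant may be added. Natural values are what a list of
-- firings and the truncations `f ∸ t` require.
nonneg-potential : (M : Fin m → Fin m → ℕ) (f : Fin m → ℤ) →
  ∃ λ (f′ : Fin m → ℕ) → ∀ u → Δ M (+_ ∘ f′) u ≡ Δ M f u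
nonneg-potential M f = f′ , λ u → Δ-cong-diff M (+_ ∘ f′) f u (λ v → begin
  + ℤ.∣ f u ℤ.+ + c ∣ ℤ.- + ℤ.∣ f v ℤ.+ + c ∣ ≡⟨ cong₂ ℤ._-_ (ℤ.0≤i⇒+∣i∣≡i (shifted≥0 u)) (ℤ.0≤i⇒+∣i∣≡i (shifted≥0 v)) ⟩
  (f u ℤ.+ + c) ℤ.- (f v ℤ.+ + c)             ≡⟨ cancel (f u) (f v) (+ c) ⟩
  f u ℤ.- f v                                 ∎)
  where
  open ≡-Reasoning
  -- The sum of all absolute values is a shift large enough for every vertex at once.
  c : ℕ
  c = sumℕ (λ u → ℤ.∣ f u ∣)
  f′ = λ u → ℤ.∣ f u ℤ.+ + c ∣
  0≤i+∣i∣ : ∀ i → 0ℤ ℤ.≤ i ℤ.+ + ℤ.∣ i ∣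
  0≤i+∣i∣ (+ i)     = ℤ.+≤+ z≤n
  0≤i+∣i∣ -[1+ i ]  = ℤ.≤-reflexive (sym (ℤ.+-inverseˡ (+ suc i)))
  shifted≥0 : ∀ u → 0ℤ ℤ.≤ f u ℤ.+ + c
  shifted≥0 u = ℤ.≤-trans (0≤i+∣i∣ (f u)) (ℤ.+-monoʳ-≤ (f u) (ℤ.+≤+ (term≤sumℕ (λ v → ℤ.∣ f v ∣) u)))
  cancel : ∀ a b c → (a ℤ.+ c) ℤ.- (b ℤ.+ c) ≡ a ℤ.- b
  cancel = solve-∀

split-δ : (f : Fin m → ℕ) (w : Fin m) → 1 ≤ f w →
  ∃ λ f′ → (∀ v → f v ≡ δ w v + f′ v) × sumℕ f ≡ suc (sumℕ f′)
split-δ f w 1≤fw = f′ , split , (begin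
  sumℕ f                      ≡⟨ sumℕ-cong split ⟩
  sumℕ (λ v → δ w v + f′ v)   ≡⟨ sumℕ-+ (δ w) f′ ⟩
  sumℕ (δ w) + sumℕ f′        ≡⟨ cong (_+ sumℕ f′) (sumℕ-δ-1 w) ⟩
  suc (sumℕ f′)               ∎)
  where
  open ≡-Reasoning
  f′ = λ v → f v ∸ δ w v
  δ≤f : ∀ v → δ w v ≤ f v
  δ≤f v with w ≟ v
  ... | yes refl = 1≤fw
  ... | no  _    = z≤n
  split : ∀ v → f v ≡ δ w v + f′ v
  split v = sym (ℕ.m+[n∸m]≡n (δ≤f v))

-- The rank condition at one vertex without any sequence of firings. Entries of `f` may be negative,
-- since equivalence also allows firings to be undone.
Movable : (G : Graph) → Divisor G → Fin (n G) → Set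
Movable G D v = ∃ λ f → ∀ u → + δ v u ℤ.≤ D u ℤ.- Δ (mult G) f u

-- Linear equivalence expressed by the Laplacian

module _ (G : Graph) (isG : IsGraph G) where

  private
    V = Fin (n G)
    L = Δ (mult G)

  -- At the fired vertex this rests on the absence of loops: a diagonal entry would count in `val`
  -- but never in `Δ`.
  fire-Δ : ∀ w D v → fire G w D v ≡ D v ℤ.- L (λ u → + δ w u) v
  fire-Δ w D v with v ≟ w
  ... | yes refl = cong (ℤ._-_ (D v)) (trans (+-sumℕ (mult G v)) (sumℤ-cong eq))
    where
    eq : ∀ x → + mult G v x ≡ + mult G v x ℤ.* (+ δ v v ℤ.- + δ v x)
    eq x with v ≟ x
    ... | yes refl rewrite proj₂ isG v = refl
    ... | no _ rewrite δ-refl v = sym (ℤ.*-identityʳ _)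
  ... | no v≢w = begin
    D v ℤ.+ + mult G v w       ≡⟨ cong (ℤ._+_ (D v)) (ℤ.neg-involutive _) ⟨
    D v ℤ.- ℤ.- + mult G v w   ≡⟨ cong (ℤ._-_ (D v)) (begin
      ℤ.- + mult G v w                              ≡⟨ cong ℤ.-_ (sumℤ-δ w (λ x → + mult G v x)) ⟨
      ℤ.- sumℤ (λ x → + δ w x ℤ.* + mult G v x)     ≡⟨ neg-distrib-sumℤ (λ x → + δ w x ℤ.* + mult G v x) ⟩
      sumℤ (λ x → ℤ.- (+ δ w x ℤ.* + mult G v x))   ≡⟨ sumℤ-cong (λ x → trans (comm (+ δ w x) (+ mult G v x))
                                                        (cong (λ d → + mult G v x ℤ.* (+ d ℤ.- + δ w x)) (sym (δ-≢ (v≢w ∘ sym))))) ⟩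
      L (λ u → + δ w u) v                            ∎) ⟩
    D v ℤ.- L (λ u → + δ w u) v ∎
    where
    open ≡-Reasoning
    comm : ∀ d x → ℤ.- (d ℤ.* x) ≡ x ℤ.* (0ℤ ℤ.- d)
    comm = solve-∀

  LinEquiv⇒Δ : ∀ {D E} → LinEquiv G D E → ∃ λ f → ∀ u → E u ≡ D u ℤ.- L f u
  LinEquiv⇒Δ {D} ε = (λ _ → 0ℤ) , λ u → sym (trans (cong (ℤ._-_ (D u)) (Δ-zero (mult G) u)) (ℤ.+-identityʳ _))
  LinEquiv⇒Δ {D} {E} (_◅_ {j = D′} (fwd (w , eq)) D′~E) with LinEquiv⇒Δ D′~E
  ... | f , eq′ = (λ v → δw v ℤ.+ f v) , λ u → begin
    E u                                 ≡⟨ eq′ u ⟩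
    D′ u ℤ.- L f u                      ≡⟨ cong (ℤ._- L f u) (trans (eq u) (fire-Δ w D u)) ⟩
    D u ℤ.- L δw u ℤ.- L f u            ≡⟨ assoc (D u) (L δw u) (L f u) ⟩
    D u ℤ.- (L δw u ℤ.+ L f u)          ≡⟨ cong (ℤ._-_ (D u)) (Δ-+ (mult G) δw f u) ⟨
    D u ℤ.- L (λ v → δw v ℤ.+ f v) u    ∎
    where
    open ≡-Reasoning
    δw = λ v → + δ w v
    assoc : ∀ a b c → a ℤ.- b ℤ.- c ≡ a ℤ.- (b ℤ.+ c)
    assoc = solve-∀
  LinEquiv⇒Δ {D} {E} (_◅_ {j = D′} (bwd (w , eq)) D′~E) with LinEquiv⇒Δ D′~E
  ... | f , eq′ = (λ v → ℤ.- δw v ℤ.+ f v) , λ u → begin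
    E u                                               ≡⟨ eq′ u ⟩
    D′ u ℤ.- L f u                                    ≡⟨ unfire (D′ u) (L δw u) (L f u) ⟩
    D′ u ℤ.- L δw u ℤ.- (ℤ.- L δw u ℤ.+ L f u)
      ≡⟨ cong₂ ℤ._-_ (trans (eq u) (fire-Δ w D′ u)) (trans (Δ-+ (mult G) (λ v → ℤ.- δw v) f u) (cong (ℤ._+ L f u) (Δ-neg (mult G) δw u))) ⟨
    D u ℤ.- L (λ v → ℤ.- δw v ℤ.+ f v) u              ∎
    where
    open ≡-Reasoning
    δw = λ v → + δ w v
    unfire : ∀ a b c → a ℤ.- c ≡ a ℤ.- b ℤ.- (ℤ.- b ℤ.+ c)
    unfire = solve-∀

  -- Induction on the total number of firings: some vertex with `f w` positive is fired last, and
  -- the rest of `f` is handled by the induction.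
  Δ⇒LinEquiv : ∀ D (f : V → ℕ) → ∃ λ E → LinEquiv G D E × (∀ u → E u ≡ D u ℤ.- L (+_ ∘ f) u)
  Δ⇒LinEquiv D f = go (sumℕ f) f refl
    where
    go : ∀ c f → sumℕ f ≡ c → ∃ λ E → LinEquiv G D E × (∀ u → E u ≡ D u ℤ.- L (+_ ∘ f) u)
    go zero f Σf≡0 = D , ε , λ u → sym (trans (cong (ℤ._-_ (D u)) (trans (Δ-cong (mult G) f≗0 u) (Δ-zero (mult G) u))) (ℤ.+-identityʳ _))
      where
      f≗0 : ∀ v → + f v ≡ 0ℤ
      f≗0 v = cong +_ (ℕ.n≤0⇒n≡0 (ℕ.≤-trans (term≤sumℕ f v) (ℕ.≤-reflexive Σf≡0)))
    go (suc c) f Σf≡1+c with any? (λ w → 1 ℕ.≤? f w)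
    ... | no  f≯0 = contradiction (trans (sym Σf≡1+c) (sumℕ-zero (λ v → ℕ.n<1⇒n≡0 (ℕ.≰⇒> (λ 1≤fv → f≯0 (v , 1≤fv)))))) λ ()
    ... | yes (w , 1≤fw) with split-δ f w 1≤fw
    ...   | f′ , f≗ , Σf≡ with go c f′ (ℕ.suc-injective (trans (sym Σf≡) Σf≡1+c))
    ...     | E , D~E , eq = fire G w E , D~E ◅◅ (fwd (w , λ _ → refl) ◅ ε) , λ u → begin
      fire G w E u                               ≡⟨ fire-Δ w E u ⟩
      E u ℤ.- L δw u                             ≡⟨ cong (ℤ._- L δw u) (eq u) ⟩
      D u ℤ.- L (+_ ∘ f′) u ℤ.- L δw u           ≡⟨ assoc (D u) (L (+_ ∘ f′) u) (L δw u) ⟩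
      D u ℤ.- (L δw u ℤ.+ L (+_ ∘ f′) u)         ≡⟨ cong (ℤ._-_ (D u)) (Δ-+ (mult G) δw (+_ ∘ f′) u) ⟨
      D u ℤ.- L (λ v → δw v ℤ.+ + f′ v) u        ≡⟨ cong (ℤ._-_ (D u)) (Δ-cong (mult G) (λ v → cong +_ (f≗ v)) u) ⟨
      D u ℤ.- L (+_ ∘ f) u                       ∎
      where
      open ≡-Reasoning
      δw = λ v → + δ w v
      assoc : ∀ a b c → a ℤ.- b ℤ.- c ≡ a ℤ.- (c ℤ.+ b)
      assoc = solve-∀

  minusPoint-δ : ∀ D v u → minusPoint {G} D v u ≡ D u ℤ.- + δ v u
  minusPoint-δ D v u rewrite δ-sym v u with u ≟ v
  ... | yes _ = refl
  ... | no  _ = sym (ℤ.+-identityʳ _)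

  PositiveRank⇒Movable : ∀ {D} → PositiveRank G D → ∀ v → Movable G D v
  PositiveRank⇒Movable {D} rank v with rank v
  ... | E , D-v~E , E≥0 with LinEquiv⇒Δ D-v~E
  ...   | f , eq = f , λ u → ℤ.0≤i-j⇒j≤i (ℤ.≤-trans (E≥0 u) (ℤ.≤-reflexive (begin
      E u                                       ≡⟨ eq u ⟩
      minusPoint {G} D v u ℤ.- L f u            ≡⟨ cong (ℤ._- L f u) (minusPoint-δ D v u) ⟩
      D u ℤ.- + δ v u ℤ.- L f u                 ≡⟨ comm (D u) (+ δ v u) (L f u) ⟩
      D u ℤ.- L f u ℤ.- + δ v u                 ∎)))
    where
    open ≡-Reasoning
    comm : ∀ a b c → a ℤ.- b ℤ.- c ≡ a ℤ.- c ℤ.- b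
    comm = solve-∀

  Movable⇒PositiveRank : ∀ {D} → (∀ v → Movable G D v) → PositiveRank G D
  Movable⇒PositiveRank {D} mov v with mov v
  ... | f , le with nonneg-potential (mult G) f
  ...   | f′ , L≡ with Δ⇒LinEquiv (minusPoint {G} D v) f′
  ...     | E , D-v~E , eq = E , D-v~E , λ u → ℤ.≤-trans (ℤ.i≤j⇒0≤j-i (le u)) (ℤ.≤-reflexive (sym (begin
      E u                                           ≡⟨ eq u ⟩
      minusPoint {G} D v u ℤ.- L (+_ ∘ f′) u        ≡⟨ cong₂ ℤ._-_ (minusPoint-δ D v u) (L≡ u) ⟩
      D u ℤ.- + δ v u ℤ.- L f u                     ≡⟨ comm (D u) (+ δ v u) (L f u) ⟩
      D u ℤ.- L f u ℤ.- + δ v u                     ∎)))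
    where
    open ≡-Reasoning
    comm : ∀ a b c → a ℤ.- b ℤ.- c ≡ a ℤ.- c ℤ.- b
    comm = solve-∀

-- Scramble number is at most gonality

∈-comprehension⁺ : {χ : Fin m → Bool} {u : Fin m} → χ u ≡ true → u ∈ tabulate χ
∈-comprehension⁺ {χ = χ} {u} χu = lookup⇒[]= u (tabulate χ) (trans (lookup∘tabulate χ u) χu)

∈-comprehension⁻ : {χ : Fin m → Bool} {u : Fin m} → u ∈ tabulate χ → χ u ≡ true
∈-comprehension⁻ {χ = χ} {u} u∈ = trans (sym (lookup∘tabulate χ u)) ([]=⇒lookup u∈)

∣tabulate∣ : (χ : Fin m → Bool) → ∣ tabulate χ ∣ ≡ sumℕ (ι ∘ χ)
∣tabulate∣ {zero}  χ = refl
∣tabulate∣ {suc m} χ with χ zero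
... | true  = cong suc (∣tabulate∣ (χ ∘ suc))
... | false = ∣tabulate∣ (χ ∘ suc)

-- The upward search from `i` must stop within `d` steps, since `Q` fails at `i + d`.
last-before-change : {Q : ℕ → Set} → (∀ t → Dec (Q t)) → ∀ i d → Q i → ¬ Q (i + d) →
  ∃ λ j → i ≤ j × Q j × ¬ Q (suc j)
last-before-change {Q} Q? i zero    Qi ¬Q = contradiction (subst Q (sym (ℕ.+-identityʳ i)) Qi) ¬Q
last-before-change {Q} Q? i (suc d) Qi ¬Q with Q? (suc i)
... | no  ¬Q1+i = i , ℕ.≤-refl , Qi , ¬Q1+i
... | yes Q1+i with last-before-change Q? (suc i) d Q1+i (¬Q ∘ subst Q (sym (ℕ.+-suc i d)))
...   | j , i<j , Qj , ¬Q1+j = j , ℕ.<⇒≤ i<j , Qj , ¬Q1+j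

-- Layer-cake decomposition: lowering the truncation level by one adds the indicator of the
-- superlevel set. Thus `f` is fired as a sequence of sets.
∸-layer : ∀ a t → a ∸ t ≡ ι (t <ᵇ a) + (a ∸ suc t)
∸-layer zero    zero    = refl
∸-layer zero    (suc t) = refl
∸-layer (suc a) zero    = refl
∸-layer (suc a) (suc t) = ∸-layer a t

-- Truncation is exact at `a`, which lies above the level, and can only round `b` up.
∸-contracts : ∀ {a} b {t} → t ≤ a → + (a ∸ t) ℤ.- + (b ∸ t) ℤ.≤ + a ℤ.- + b
∸-contracts {a} b {t} t≤a = begin
  + (a ∸ t) ℤ.- + (b ∸ t)                         ≡⟨ shift (+ (a ∸ t)) (+ (b ∸ t)) (+ t) ⟩
  (+ t ℤ.+ + (a ∸ t)) ℤ.- (+ t ℤ.+ + (b ∸ t))     ≤⟨ ℤ.+-monoʳ-≤ (+ t ℤ.+ + (a ∸ t)) (ℤ.neg-mono-≤ (ℤ.+≤+ (ℕ.m≤n+m∸n b t))) ⟩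
  (+ t ℤ.+ + (a ∸ t)) ℤ.- + b                     ≡⟨ cong (λ x → + x ℤ.- + b) (ℕ.m+[n∸m]≡n t≤a) ⟩
  + a ℤ.- + b                                     ∎
  where
  open ℤ.≤-Reasoning
  shift : ∀ x y z → x ℤ.- y ≡ (z ℤ.+ x) ℤ.- (z ℤ.+ y)
  shift = solve-∀

<ᵇ-antitone : ∀ {i j} a → i ≤ j → (i <ᵇ a) ≡ false → (j <ᵇ a) ≡ false
<ᵇ-antitone zero    i≤j _ = refl
<ᵇ-antitone {suc i} {suc j} (suc a) (s≤s i≤j) eq = <ᵇ-antitone a i≤j eq

module _ (G : Graph) (isG : IsGraph G) where

  private
    V = Fin (n G)
    L = Δ (mult G)

  Hits : Divisor G → Subset (n G) → Set
  Hits D E = ∃ λ u → u ∈ E × 0ℤ ℤ.< D u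

  hits? : ∀ D E → Dec (Hits D E)
  hits? D E = any? (λ u → (u ∈? E) ×-dec (0ℤ ℤ.<? D u))

  hits-mono : ∀ {A B E} → (∀ u → A u ℤ.≤ B u) → Hits A E → Hits B E
  hits-mono A≤B (u , u∈E , 0<Au) = u , u∈E , ℤ.<-≤-trans 0<Au (A≤B u)

  deg-Δ : ∀ D f → sumℤ (λ u → D u ℤ.- L f u) ≡ sumℤ D
  deg-Δ D f = begin
    sumℤ (λ u → D u ℤ.- L f u)             ≡⟨ sumℤ-+ D (λ u → ℤ.- L f u) ⟩
    sumℤ D ℤ.+ sumℤ (λ u → ℤ.- L f u)      ≡⟨ cong (ℤ._+_ (sumℤ D)) (neg-distrib-sumℤ (L f)) ⟨
    sumℤ D ℤ.- sumℤ (L f)                  ≡⟨ cong (ℤ._-_ (sumℤ D)) (Δ-sum (mult G) (proj₁ isG) f) ⟩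
    sumℤ D ℤ.- 0ℤ                          ≡⟨ ℤ.+-identityʳ _ ⟩
    sumℤ D                                 ∎
    where open ≡-Reasoning

  movable-Δ : ∀ {D v} h → Movable G D v → Movable G (λ u → D u ℤ.- L h u) v
  movable-Δ {D} {v} h (f , le) = (λ u → f u ℤ.- h u) , λ u → ℤ.≤-trans (le u) (ℤ.≤-reflexive (begin
    D u ℤ.- L f u                                    ≡⟨ split (D u) (L f u) (L h u) ⟩
    D u ℤ.- L h u ℤ.- (L f u ℤ.- L h u)              ≡⟨ cong (λ x → D u ℤ.- L h u ℤ.- (L f u ℤ.+ x)) (Δ-neg (mult G) h u) ⟨
    D u ℤ.- L h u ℤ.- (L f u ℤ.+ L (λ w → ℤ.- h w) u) ≡⟨ cong (ℤ._-_ (D u ℤ.- L h u)) (Δ-+ (mult G) f (λ w → ℤ.- h w) u) ⟨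
    D u ℤ.- L h u ℤ.- L (λ w → f w ℤ.- h w) u        ∎))
    where
    open ≡-Reasoning
    split : ∀ d a b → d ℤ.- a ≡ d ℤ.- b ℤ.- (a ℤ.- b)
    split = solve-∀

  outdeg : (V → Bool) → V → ℕ
  outdeg χ u = sumℕ (λ v → if χ u ∧ not (χ v) then mult G u v else 0)

  Δ-indicator : ∀ (χ : V → Bool) u → χ u ≡ true → L (λ v → + ι (χ v)) u ≡ + outdeg χ u
  Δ-indicator χ u χu = trans (sumℤ-cong eq) (sym (+-sumℕ (λ v → if χ u ∧ not (χ v) then mult G u v else 0)))
    where
    eq : ∀ v → + mult G u v ℤ.* (+ ι (χ u) ℤ.- + ι (χ v)) ≡ + (if χ u ∧ not (χ v) then mult G u v else 0)
    eq v rewrite χu with χ v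
    ... | true  = ℤ.*-zeroʳ (+ mult G u v)
    ... | false = ℤ.*-identityʳ (+ mult G u v)

  -- The two indicators add up to a constant, so firing the complement of a set undoes firing the
  -- set.
  Δ-co-indicator : ∀ (χ : V → Bool) u → L (λ v → + ι (not (χ v))) u ≡ ℤ.- L (λ v → + ι (χ v)) u
  Δ-co-indicator χ u = trans
    (Δ-cong-diff (mult G) (λ v → + ι (not (χ v))) (λ v → ℤ.- + ι (χ v)) u (λ v → eq (χ u) (χ v)))
    (Δ-neg (mult G) (λ v → + ι (χ v)) u)
    where
    eq : ∀ a b → + ι (not a) ℤ.- + ι (not b) ≡ ℤ.- + ι a ℤ.- ℤ.- + ι b
    eq true  true  = refl
    eq true  false = refl
    eq false true  = refl
    eq false false = refl

  -- If firing χ puts a chip on a connected set E that carried none, then χ misses E: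
  -- a vertex of χ in E would push chips across an edge of E leaving χ, or E ⊆ χ gains nothing.
  newly-hit⇒outside : ∀ {E} (χ : V → Bool) (A B : Divisor G) → InducesConnected G E →
    (∀ u → 0ℤ ℤ.≤ A u) → (∀ u → 0ℤ ℤ.≤ B u) → (∀ u → B u ≡ A u ℤ.- L (λ v → + ι (χ v)) u) →
    ¬ Hits A E → Hits B E → ∀ u → u ∈ E → χ u ≡ false
  newly-hit⇒outside {E} χ A B (_ , conn) A≥0 B≥0 B≡ ¬hitA (x , x∈E , 0<Bx) u u∈E with χ u in χu
  ... | false = refl
  ... | true  = contradiction 0<Bx (ℤ.≤⇒≯ (B≤0 x x∈E (spread (conn u x u∈E x∈E) χu)))
    where
    B≤-outdeg : ∀ w → w ∈ E → χ w ≡ true → B w ℤ.≤ ℤ.- + outdeg χ w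
    B≤-outdeg w w∈E χw = begin
      B w                              ≡⟨ B≡ w ⟩
      A w ℤ.- L (λ v → + ι (χ v)) w    ≡⟨ cong (ℤ._-_ (A w)) (Δ-indicator χ w χw) ⟩
      A w ℤ.- + outdeg χ w             ≤⟨ ℤ.+-monoˡ-≤ _ (ℤ.≮⇒≥ (λ 0<Aw → ¬hitA (w , w∈E , 0<Aw))) ⟩
      0ℤ ℤ.- + outdeg χ w              ≡⟨ ℤ.+-identityˡ _ ⟩
      ℤ.- + outdeg χ w                 ∎
      where open ℤ.≤-Reasoning
    B≤0 : ∀ w → w ∈ E → χ w ≡ true → B w ℤ.≤ 0ℤ
    B≤0 w w∈E χw = ℤ.≤-trans (B≤-outdeg w w∈E χw) ℤ.neg-≤-pos
    spread : ∀ {w y} → ReachIn G E w y → χ w ≡ true → χ y ≡ true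
    spread (here _) χw = χw
    spread {w} (step {w = z} w∈E 0<wz r) χw with χ z in χz
    ... | true  = spread r χz
    ... | false = contradiction outdeg≤0 (ℕ.<⇒≱ (ℕ.<-≤-trans 0<wz wz≤outdeg))
      where
      outdeg≤0 : outdeg χ w ≤ 0
      outdeg≤0 = ℤ.drop‿+≤+ (ℤ.neg-cancel-≤ (ℤ.≤-trans (B≥0 w) (B≤-outdeg w w∈E χw)))
      term : (if χ w ∧ not (χ z) then mult G w z else 0) ≡ mult G w z
      term rewrite χw | χz = refl
      wz≤outdeg : mult G w z ≤ outdeg χ w
      wz≤outdeg = subst (_≤ outdeg χ w) term (term≤sumℕ (λ v → if χ w ∧ not (χ v) then mult G w v else 0) z)

  -- A fired vertex sends `outdeg χ u` chips across the boundary and ends without debt, so it held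
  -- at least that many; at the other vertices `outdeg` is zero.
  cut≤deg : ∀ (χ : V → Bool) (A B : Divisor G) → (∀ u → 0ℤ ℤ.≤ A u) → (∀ u → 0ℤ ℤ.≤ B u) →
    (∀ u → B u ≡ A u ℤ.- L (λ v → + ι (χ v)) u) → + cutSize G (tabulate χ) ℤ.≤ sumℤ A
  cut≤deg χ A B A≥0 B≥0 B≡ = begin
    + cutSize G (tabulate χ)      ≡⟨ cong +_ (sumℕ-cong (λ u → sumℕ-cong (λ v →
                                       cong₂ (λ a b → if a ∧ not b then mult G u v else 0) (lookup∘tabulate χ u) (lookup∘tabulate χ v)))) ⟩
    + sumℕ (outdeg χ)             ≡⟨ +-sumℕ (outdeg χ) ⟩
    sumℤ (λ u → + outdeg χ u)     ≤⟨ sumℤ-mono outdeg≤A ⟩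
    sumℤ A                        ∎
    where
    open ℤ.≤-Reasoning
    outdeg≤A : ∀ u → + outdeg χ u ℤ.≤ A u
    outdeg≤A u with χ u ≟ᵇ true
    ... | yes χu = ℤ.0≤i-j⇒j≤i (ℤ.≤-trans (B≥0 u) (ℤ.≤-reflexive (trans (B≡ u) (cong (ℤ._-_ (A u)) (Δ-indicator χ u χu)))))
    ... | no χu≢ = ℤ.≤-trans (ℤ.≤-reflexive (cong +_ (sumℕ-zero (λ v →
                     cong (λ a → if a ∧ not (χ v) then mult G u v else 0) (¬-not χu≢))))) (A≥0 u)

  -- The measure that decreases each time the divisor in `scrambleOrder≤deg` is improved.
  unhit : Divisor G → List (Subset (n G)) → ℕ
  unhit D []       = 0
  unhit D (E ∷ es) = ι (not ⌊ hits? D E ⌋) + unhit D es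

  miss-mono : ∀ {D D′ E} → (Hits D E → Hits D′ E) → ι (not ⌊ hits? D′ E ⌋) ≤ ι (not ⌊ hits? D E ⌋)
  miss-mono {D} {D′} {E} imp with hits? D E | hits? D′ E
  ... | yes h | no ¬h = contradiction (imp h) ¬h
  ... | _     | yes _ = z≤n
  ... | no _  | no _  = ℕ.≤-refl

  unhit-mono : ∀ {D D′} es → (∀ E → E ∈ₗ es → Hits D E → Hits D′ E) → unhit D′ es ≤ unhit D es
  unhit-mono []       imp = z≤n
  unhit-mono {D} {D′} (E ∷ es) imp = ℕ.+-mono-≤ (miss-mono (imp E (here refl))) (unhit-mono es (λ F F∈ → imp F (there F∈)))

  unhit-< : ∀ {D D′ E} es → (∀ E → E ∈ₗ es → Hits D E → Hits D′ E) →
    E ∈ₗ es → ¬ Hits D E → Hits D′ E → unhit D′ es < unhit D es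
  unhit-< {D} {D′} {E} (F ∷ es) imp (here refl) ¬h h′ with hits? D E | hits? D′ E
  ... | yes h | _     = contradiction h ¬h
  ... | no _  | no ¬h′ = contradiction h′ ¬h′
  ... | no _  | yes _ = s≤s (unhit-mono es (λ F F∈ → imp F (there F∈)))
  unhit-< {D} {D′} (F ∷ es) imp (there E∈) ¬h h′ =
    ℕ.+-mono-≤-< (miss-mono (imp F (here refl))) (unhit-< es (λ F F∈ → imp F (there F∈)) E∈ ¬h h′)

  support : Divisor G → Subset (n G)
  support D = tabulate (λ u → ⌊ 0ℤ ℤ.<? D u ⌋)

  ∣support∣≤deg : ∀ D → (∀ u → 0ℤ ℤ.≤ D u) → + ∣ support D ∣ ℤ.≤ sumℤ D
  ∣support∣≤deg D D≥0 = begin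
    + ∣ support D ∣                            ≡⟨ cong +_ (∣tabulate∣ (λ u → ⌊ 0ℤ ℤ.<? D u ⌋)) ⟩
    + sumℕ (λ u → ι ⌊ 0ℤ ℤ.<? D u ⌋)           ≡⟨ +-sumℕ (λ u → ι ⌊ 0ℤ ℤ.<? D u ⌋) ⟩
    sumℤ (λ u → + ι ⌊ 0ℤ ℤ.<? D u ⌋)           ≤⟨ sumℤ-mono le ⟩
    sumℤ D                                     ∎
    where
    open ℤ.≤-Reasoning
    le : ∀ u → + ι ⌊ 0ℤ ℤ.<? D u ⌋ ℤ.≤ D u
    le u with 0ℤ ℤ.<? D u
    ... | yes 0<Du = ℤ.i<j⇒suc[i]≤j 0<Du
    ... | no  _    = D≥0 u

  ∈-support : ∀ D u → 0ℤ ℤ.< D u → u ∈ support D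
  ∈-support D u 0<Du = ∈-comprehension⁺ eq
    where
    eq : ⌊ 0ℤ ℤ.<? D u ⌋ ≡ true
    eq with 0ℤ ℤ.<? D u
    ... | yes _ = refl
    ... | no ≮  = contradiction 0<Du ≮

  -- Levels run against the order of firing: `layer t` is `D` for large `t`, and `layer 0` is the
  -- target `D - Δ f`. Passing from level `suc t` to `t` fires the set `above t`.
  module Layers (D : Divisor G) (D≥0 : ∀ u → 0ℤ ℤ.≤ D u) (f : V → ℕ)
                (D-f≥0 : ∀ u → 0ℤ ℤ.≤ D u ℤ.- L (λ v → + f v) u) where

    layer : ℕ → Divisor G
    layer t u = D u ℤ.- L (λ v → + (f v ∸ t)) u

    above : ℕ → V → Bool
    above t v = t <ᵇ f v

    -- A vertex with `f u` at least `t` has lost no more chips than it loses under the whole of `f`.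
    -- A vertex with `f u` at most `t` has not been fired yet, so it has only gained chips.
    layer≥0 : ∀ t u → 0ℤ ℤ.≤ layer t u
    layer≥0 t u with ℕ.≤-total t (f u)
    ... | inj₁ t≤fu = ℤ.≤-trans (D-f≥0 u) (ℤ.+-monoʳ-≤ (D u) (ℤ.neg-mono-≤
            (Δ-mono (mult G) {λ v → + (f v ∸ t)} {λ v → + f v} u (λ v → ∸-contracts (f v) t≤fu))))
    ... | inj₂ fu≤t = ℤ.≤-trans (D≥0 u) (ℤ.≤-trans (ℤ.≤-reflexive (sym (ℤ.+-identityʳ (D u)))) (ℤ.+-monoʳ-≤ (D u) (ℤ.neg-mono-≤
            (ℤ.≤-trans (Δ-mono (mult G) {λ v → + (f v ∸ t)} {λ _ → 0ℤ} u (λ v →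
              ℤ.≤-trans (ℤ.≤-reflexive (trans (cong (λ a → + a ℤ.- + (f v ∸ t)) (ℕ.m≤n⇒m∸n≡0 fu≤t)) (ℤ.+-identityˡ (ℤ.- + (f v ∸ t))))) (ℤ.neg-≤-pos {f v ∸ t} {0})))
            (ℤ.≤-reflexive (Δ-zero (mult G) u))))))

    layer-step : ∀ t u → layer t u ≡ layer (suc t) u ℤ.- L (λ v → + ι (above t v)) u
    layer-step t u = begin
      D u ℤ.- L (λ v → + (f v ∸ t)) u
        ≡⟨ cong (ℤ._-_ (D u)) (trans (Δ-cong (mult G) (λ v → cong +_ (∸-layer (f v) t)) u)
             (Δ-+ (mult G) (λ v → + ι (above t v)) (λ v → + (f v ∸ suc t)) u)) ⟩
      D u ℤ.- (L (λ v → + ι (above t v)) u ℤ.+ L (λ v → + (f v ∸ suc t)) u)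
        ≡⟨ assoc (D u) (L (λ v → + ι (above t v)) u) (L (λ v → + (f v ∸ suc t)) u) ⟩
      layer (suc t) u ℤ.- L (λ v → + ι (above t v)) u ∎
      where
      open ≡-Reasoning
      assoc : ∀ d a b → d ℤ.- (a ℤ.+ b) ≡ d ℤ.- b ℤ.- a
      assoc = solve-∀

    -- The same step run backwards, as a firing of the complement; this makes `newly-hit⇒outside`
    -- applicable to an egg that a forward step loses.
    layer-step′ : ∀ t u → layer (suc t) u ≡ layer t u ℤ.- L (λ v → + ι (not (above t v))) u
    layer-step′ t u = begin
      layer (suc t) u              ≡⟨ cancel (layer (suc t) u) (L (λ v → + ι (above t v)) u) ⟩
      layer (suc t) u ℤ.- L (λ v → + ι (above t v)) u ℤ.- ℤ.- L (λ v → + ι (above t v)) u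
        ≡⟨ cong₂ ℤ._-_ (layer-step t u) (Δ-co-indicator (above t) u) ⟨
      layer t u ℤ.- L (λ v → + ι (not (above t v))) u ∎
      where
      open ≡-Reasoning
      cancel : ∀ a b → a ≡ a ℤ.- b ℤ.- ℤ.- b
      cancel = solve-∀

    layer-top : ∀ {t} → sumℕ f ≤ t → ∀ u → layer t u ≡ D u
    layer-top {t} Σf≤t u = trans (cong (ℤ._-_ (D u)) (trans
      (Δ-cong (mult G) {λ v → + (f v ∸ t)} {λ _ → 0ℤ}
        (λ v → cong +_ (ℕ.m≤n⇒m∸n≡0 (ℕ.≤-trans (term≤sumℕ f v) Σf≤t))) u)
      (Δ-zero (mult G) u))) (ℤ.+-identityʳ (D u))

  scrambleOrder≤deg : V → ∀ {D} → PositiveRank G D → ∀ (S : Scramble G) k → OrderAtLeast S k → + k ℤ.≤ sumℤ D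
  scrambleOrder≤deg v₀ {D₀} rank S k (k≤hit , k≤cut) with PositiveRank⇒Movable G isG rank
  ... | mov₀ with mov₀ v₀
  -- Moving a chip to `v₀` yields an equivalent divisor that is effective, from which the
  -- improvement can start.
  ... | f₀ , le₀ = ℤ.≤-trans
      (go (suc (unhit D₁ eggs)) D₁ (λ u → ℤ.≤-trans (ℤ.+≤+ z≤n) (le₀ u)) (λ v → movable-Δ {D₀} f₀ (mov₀ v)) ℕ.≤-refl)
      (ℤ.≤-reflexive (deg-Δ D₀ f₀))
    where
    eggs = eggsOf S
    D₁ : Divisor G
    D₁ u = D₀ u ℤ.- L f₀ u

    go : ∀ c D → (∀ u → 0ℤ ℤ.≤ D u) → (∀ v → Movable G D v) → unhit D eggs < c → + k ℤ.≤ sumℤ D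
    go (suc c) D D≥0 mov (s≤s unhit≤c) with Any.any? (λ E → ¬? (hits? D E)) eggs
    ... | no all-hit = ℤ.≤-trans (ℤ.+≤+ (k≤hit (support D) hitting)) (∣support∣≤deg D D≥0)
      where
      hitting : Hitting S (support D)
      hitting E E∈ with decidable-stable (hits? D E) (λ ¬h → all-hit (lose E∈ ¬h))
      ... | u , u∈E , 0<Du = u , u∈E , ∈-support D u 0<Du
    ... | yes some-unhit with find some-unhit
    ...   | E , E∈ , ¬hitE with proj₁ (proj₂ S E E∈)
    -- Any vertex of the missed egg serves as target: a chip moved there makes level 0 hit `E`,
    -- while the top level, which is `D`, misses it.
    ...     | v , v∈E with mov v
    ...       | f , le with nonneg-potential (mult G) f
    ...         | f′ , L≡ = approach
      where
      le′ : ∀ u → + δ v u ℤ.≤ D u ℤ.- L (λ w → + f′ w) u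
      le′ u = ℤ.≤-trans (le u) (ℤ.≤-reflexive (cong (ℤ._-_ (D u)) (sym (L≡ u))))

      open Layers D D≥0 f′ (λ u → ℤ.≤-trans (ℤ.+≤+ z≤n) (le′ u))

      N = sumℕ f′

      hit₀ : Hits (layer 0) E
      hit₀ = v , v∈E , ℤ.<-≤-trans (ℤ.+<+ (s≤s z≤n)) (subst (λ a → + a ℤ.≤ layer 0 v) (δ-refl v) (le′ v))

      ¬hitN : ¬ Hits (layer N) E
      ¬hitN h = ¬hitE (hits-mono {E = E} (λ u → ℤ.≤-reflexive (layer-top ℕ.≤-refl u)) h)

      approach : + k ℤ.≤ sumℤ D
      -- Only the transition matters: firing `above j` turns a divisor that misses `E` into one that
      -- hits it.
      approach with last-before-change (λ t → hits? (layer t) E) 0 N hit₀ ¬hitN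
      ... | j , _ , hit-j , ¬hit-1+j with Any.any? (λ F → hits? D F ×-dec ¬? (hits? (layer j) F)) eggs
      -- No egg hit by `D` is lost and `E` is gained, so `layer j` misses fewer eggs at the same
      -- degree.
      ...   | no none-lost = ℤ.≤-trans
          (go c (layer j) (layer≥0 j) (λ w → movable-Δ {D} (λ u → + (f′ u ∸ j)) (mov w))
            (ℕ.<-≤-trans (unhit-< eggs (λ F F∈ hF → decidable-stable (hits? (layer j) F) (λ ¬h → none-lost (lose F∈ (hF , ¬h)))) E∈ ¬hitE hit-j) unhit≤c))
          (ℤ.≤-reflexive (deg-Δ D (λ u → + (f′ u ∸ j))))
      -- `F` is hit by `D`, the layer at level `j + N`, but missed at level `j`, so it is lost in
      -- the step from some level `suc i` to `i` with `i` at least `j`. Then `F` lies inside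
      -- `above i`. As `E` avoids `above j`, it also avoids the smaller set `above i`, which
      -- therefore separates the two eggs.
      ...   | yes some-lost with find some-lost
      ...     | F , F∈ , hitF , ¬hitF-j
          with last-before-change (λ t → ¬? (hits? (layer t) F)) j N ¬hitF-j
                 (λ ¬h → ¬h (hits-mono {E = F} (λ u → ℤ.≤-reflexive (sym (layer-top (ℕ.m≤n+m N j) u))) hitF))
      ...       | i , j≤i , ¬hitF-i , hitF-1+i = ℤ.≤-trans
          (ℤ.+≤+ (k≤cut (tabulate (above i)) ((F , F∈ , F⊆) , (E , E∈ , E⊆))))
          (ℤ.≤-trans (cut≤deg (above i) (layer (suc i)) (layer i) (layer≥0 (suc i)) (layer≥0 i) (layer-step i))
            (ℤ.≤-reflexive (deg-Δ D (λ u → + (f′ u ∸ suc i)))))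
        where
        E-below : ∀ u → u ∈ E → above j u ≡ false
        E-below = newly-hit⇒outside (above j) (layer (suc j)) (layer j) (proj₂ S E E∈)
          (layer≥0 (suc j)) (layer≥0 j) (layer-step j) ¬hit-1+j hit-j
        F-above : ∀ u → u ∈ F → not (above i u) ≡ false
        F-above = newly-hit⇒outside (not ∘ above i) (layer i) (layer (suc i)) (proj₂ S F F∈)
          (layer≥0 i) (layer≥0 (suc i)) (layer-step′ i) ¬hitF-i (decidable-stable (hits? (layer (suc i)) F) hitF-1+i)
        F⊆ : F ⊆ tabulate (above i)
        F⊆ {u} u∈F = ∈-comprehension⁺ (trans (sym (not-involutive (above i u))) (cong not (F-above u u∈F)))
        E⊆ : E ⊆ ∁ (tabulate (above i))
        E⊆ {u} u∈E = x∉p⇒x∈∁p (λ u∈ → contradiction (trans (sym (∈-comprehension⁻ {χ = above i} u∈)) (<ᵇ-antitone (f′ u) j≤i (E-below u u∈E))) λ ())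

-- Cartesian products

δ-≤ : {x y : Fin m} {i j : Fin k} → (x ≡ y → i ≡ j) → δ x y ≤ δ i j
δ-≤ {x = x} {y} {i} {j} imp with x ≟ y
... | no  _   = z≤n
... | yes x≡y with refl ← imp x≡y = ℕ.≤-reflexive (sym (δ-refl i))

Δ-const : (M : Fin m → Fin m → ℕ) (f : Fin m → ℤ) {c : ℤ} → (∀ u → f u ≡ c) → ∀ u → Δ M f u ≡ 0ℤ
Δ-const M f {c} f≡c u = trans
  (Δ-cong-diff M f (λ _ → 0ℤ) u (λ v → trans (cong₂ ℤ._-_ (f≡c u) (f≡c v)) (ℤ.+-inverseʳ c)))
  (Δ-zero M u)

-- Descent on the cut size, starting from one nontrivial cut. Such a cut has to be supplied because
-- a graph with a single vertex has no value to find.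
edgeConnectivity-exists : ∀ G A → Nonempty A → Nonempty (∁ A) → ∃ (IsEdgeConnectivity G)
edgeConnectivity-exists G A ne ne∁ = go (suc (cutSize G A)) A ne ne∁ ℕ.≤-refl
  where
  go : ∀ c A → Nonempty A → Nonempty (∁ A) → cutSize G A < c → ∃ (IsEdgeConnectivity G)
  go (suc c) A ne ne∁ (s≤s cut≤c)
    with anySubset? (λ B → nonempty? B ×-dec nonempty? (∁ B) ×-dec cutSize G B ℕ.<? cutSize G A)
  ... | yes (B , neB , neB∁ , less) = go c B neB neB∁ (ℕ.<-≤-trans less cut≤c)
  ... | no none = cutSize G A , (A , ne , ne∁ , refl) , λ B neB neB∁ → ℕ.≮⇒≥ (λ less → none (B , neB , neB∁ , less))

-- Maximality of the scramble and minimality of the divisor are one inequality, each time with one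
-- of the two given witnesses held fixed.
scramble+divisor⇒sn≡gon : ∀ G → IsGraph G → Fin (n G) → ∀ s →
  (Σ (Scramble G) λ S → OrderAtLeast S s) →
  (Σ (Divisor G) λ D → PositiveRank G D × deg {G} D ≡ + s) →
  IsScrambleNumber G s × IsGonality G s
scramble+divisor⇒sn≡gon G isG v s (S , ord) (D , rank , deg≡) =
  ((S , ord) , λ S′ k ord′ → ℤ.drop‿+≤+ (ℤ.≤-trans (scrambleOrder≤deg G isG v rank S′ k ord′) (ℤ.≤-reflexive deg≡))) ,
  ((D , rank , deg≡) , λ D′ rank′ → scrambleOrder≤deg G isG v rank′ S s ord)

module _ (G H : Graph) (isG : IsGraph G) (isH : IsGraph H) where

  private
    P = G □ H
    pair : Fin (n G) → Fin (n H) → Fin (n P)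
    pair = combine

  mult-□ : ∀ u v u′ v′ → mult P (combine u v) (combine u′ v′) ≡ δ u u′ * mult H v v′ + δ v v′ * mult G u u′
  mult-□ u v u′ v′ = trans (cong₂ multPair (remQuot-combine u v) (remQuot-combine u′ v′)) (cong₂ _+_ (if-ι ⌊ u ≟ u′ ⌋) (if-ι ⌊ v ≟ v′ ⌋))
    where
    -- The body of `_□_` with the decomposed vertices as arguments, so that `remQuot-combine` can
    -- act under a congruence.
    multPair : Fin (n G) × Fin (n H) → Fin (n G) × Fin (n H) → ℕ
    multPair (u , v) (u′ , v′) = (if ⌊ u ≟ u′ ⌋ then mult H v v′ else 0) + (if ⌊ v ≟ v′ ⌋ then mult G u u′ else 0)
    if-ι : ∀ b {x} → (if b then x else 0) ≡ ι b * x
    if-ι true  = sym (ℕ.+-identityʳ _)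
    if-ι false = refl

  □-isGraph : IsGraph P
  □-isGraph = symm , loopless
    where
    symm : ∀ x y → mult P x y ≡ mult P y x
    symm x y with combine-surjective {n G} {n H} x | combine-surjective {n G} {n H} y
    ... | u , v , refl | u′ , v′ , refl = begin
      mult P (combine u v) (combine u′ v′)            ≡⟨ mult-□ u v u′ v′ ⟩
      δ u u′ * mult H v v′ + δ v v′ * mult G u u′     ≡⟨ cong₂ _+_ (cong₂ _*_ (δ-sym u u′) (proj₁ isH v v′)) (cong₂ _*_ (δ-sym v v′) (proj₁ isG u u′)) ⟩
      δ u′ u * mult H v′ v + δ v′ v * mult G u′ u     ≡⟨ mult-□ u′ v′ u v ⟨
      mult P (combine u′ v′) (combine u v)            ∎
      where open ≡-Reasoning
    loopless : ∀ x → mult P x x ≡ 0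
    loopless x with combine-surjective {n G} {n H} x
    ... | u , v , refl = trans (mult-□ u v u v)
      (cong₂ _+_ (trans (cong (δ u u *_) (proj₂ isH v)) (ℕ.*-zeroʳ (δ u u))) (trans (cong (δ v v *_) (proj₂ isG u)) (ℕ.*-zeroʳ (δ v v))))

  -- Every edge of the product at `(u , v)` changes exactly one coordinate; the deltas in `mult-□`
  -- collapse the double sum to the two fibres through that vertex.
  Δ-□ : ∀ F u v → Δ (mult P) F (combine u v) ≡
    Δ (mult G) (λ u′ → F (combine u′ v)) u ℤ.+ Δ (mult H) (λ v′ → F (combine u v′)) v
  Δ-□ F u v = begin
    Δ (mult P) F (combine u v)
      ≡⟨ sumℤ-combine (n G) {n H} (λ y → + mult P (combine u v) y ℤ.* (F (combine u v) ℤ.- F y)) ⟩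
    sumℤ (λ u′ → sumℤ (λ v′ → + mult P (combine u v) (combine u′ v′) ℤ.* diff u′ v′))
      ≡⟨ sumℤ-cong (λ u′ → sumℤ-cong (λ v′ → expand u′ v′)) ⟩
    sumℤ (λ u′ → sumℤ (λ v′ → + δ v v′ ℤ.* gTerm u′ v′ ℤ.+ + δ u u′ ℤ.* hTerm u′ v′))
      ≡⟨ sumℤ-cong (λ u′ → sumℤ-+ (λ v′ → + δ v v′ ℤ.* gTerm u′ v′) (λ v′ → + δ u u′ ℤ.* hTerm u′ v′)) ⟩
    sumℤ (λ u′ → sumℤ (λ v′ → + δ v v′ ℤ.* gTerm u′ v′) ℤ.+ sumℤ (λ v′ → + δ u u′ ℤ.* hTerm u′ v′))
      ≡⟨ sumℤ-+ (λ u′ → sumℤ (λ v′ → + δ v v′ ℤ.* gTerm u′ v′)) (λ u′ → sumℤ (λ v′ → + δ u u′ ℤ.* hTerm u′ v′)) ⟩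
    sumℤ (λ u′ → sumℤ (λ v′ → + δ v v′ ℤ.* gTerm u′ v′)) ℤ.+ sumℤ (λ u′ → sumℤ (λ v′ → + δ u u′ ℤ.* hTerm u′ v′))
      ≡⟨ cong₂ ℤ._+_ (sumℤ-cong (λ u′ → sumℤ-δ v (gTerm u′)))
           (trans (sumℤ-swap (λ u′ v′ → + δ u u′ ℤ.* hTerm u′ v′)) (sumℤ-cong (λ v′ → sumℤ-δ u (λ u′ → hTerm u′ v′)))) ⟩
    sumℤ (λ u′ → gTerm u′ v) ℤ.+ sumℤ (λ v′ → hTerm u v′) ∎
    where
    open ≡-Reasoning
    diff : Fin (n G) → Fin (n H) → ℤ
    diff u′ v′ = F (combine u v) ℤ.- F (combine u′ v′)
    gTerm hTerm : Fin (n G) → Fin (n H) → ℤ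
    gTerm u′ v′ = + mult G u u′ ℤ.* diff u′ v′
    hTerm u′ v′ = + mult H v v′ ℤ.* diff u′ v′
    distrib : ∀ a b c d x → (a ℤ.* b ℤ.+ c ℤ.* d) ℤ.* x ≡ c ℤ.* (d ℤ.* x) ℤ.+ a ℤ.* (b ℤ.* x)
    distrib = solve-∀
    expand : ∀ u′ v′ → + mult P (combine u v) (combine u′ v′) ℤ.* diff u′ v′ ≡ + δ v v′ ℤ.* gTerm u′ v′ ℤ.+ + δ u u′ ℤ.* hTerm u′ v′
    expand u′ v′ = trans
      (cong (ℤ._* diff u′ v′) (trans (cong +_ (mult-□ u v u′ v′)) (cong₂ ℤ._+_ (ℤ.pos-* (δ u u′) (mult H v v′)) (ℤ.pos-* (δ v v′) (mult G u u′)))))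
      (distrib (+ δ u u′) (+ mult H v v′) (+ δ v v′) (+ mult G u u′) (diff u′ v′))

  -- Pulling divisors back along the projections

  private
    π₁ : Fin (n P) → Fin (n G)
    π₁ = quotient {n G} (n H)
    π₂ : Fin (n P) → Fin (n H)
    π₂ = remainder {n G} (n H)
    π₁-combine : ∀ u v → π₁ (combine u v) ≡ u
    π₁-combine u v = cong proj₁ (remQuot-combine u v)
    π₂-combine : ∀ u v → π₂ (combine u v) ≡ v
    π₂-combine u v = cong proj₂ (remQuot-combine {n G} u v)

  movable-π₁ : ∀ {D} → (∀ u → Movable G D u) → ∀ x → Movable P (D ∘ π₁) x
  movable-π₁ {D} mov x with combine-surjective {n G} {n H} x
  ... | u₀ , v₀ , refl with mov u₀
  ...   | f , le = f ∘ π₁ , bound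
    where
    Δ≡ : ∀ u v → Δ (mult P) (f ∘ π₁) (combine u v) ≡ Δ (mult G) f u
    Δ≡ u v = trans (Δ-□ (f ∘ π₁) u v) (trans (cong₂ ℤ._+_
      (Δ-cong (mult G) (λ u′ → cong f (π₁-combine u′ v)) u)
      (Δ-const (mult H) (λ v′ → f (π₁ (combine u v′))) (λ v′ → cong f (π₁-combine u v′)) v)) (ℤ.+-identityʳ _))
    bound : ∀ y → + δ (combine u₀ v₀) y ℤ.≤ D (π₁ y) ℤ.- Δ (mult P) (f ∘ π₁) y
    bound y with combine-surjective {n G} {n H} y
    -- The pulled-back firing puts a chip on the entire fibre over `u₀`, of which only the one at
    -- `v₀` is asked for.
    ... | u , v , refl = ℤ.≤-trans (ℤ.+≤+ (δ-≤ (combine-injectiveˡ u₀ v₀ u v)))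
      (ℤ.≤-trans (le u) (ℤ.≤-reflexive (sym (cong₂ ℤ._-_ (cong D (π₁-combine u v)) (Δ≡ u v)))))

  movable-π₂ : ∀ {D} → (∀ v → Movable H D v) → ∀ x → Movable P (D ∘ π₂) x
  movable-π₂ {D} mov x with combine-surjective {n G} {n H} x
  ... | u₀ , v₀ , refl with mov v₀
  ...   | f , le = f ∘ π₂ , bound
    where
    Δ≡ : ∀ u v → Δ (mult P) (f ∘ π₂) (combine u v) ≡ Δ (mult H) f v
    Δ≡ u v = trans (Δ-□ (f ∘ π₂) u v) (trans (cong₂ ℤ._+_
      (Δ-const (mult G) (λ u′ → f (π₂ (combine u′ v))) (λ u′ → cong f (π₂-combine u′ v)) u)
      (Δ-cong (mult H) (λ v′ → cong f (π₂-combine u v′)) v)) (ℤ.+-identityˡ _))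
    bound : ∀ y → + δ (combine u₀ v₀) y ℤ.≤ D (π₂ y) ℤ.- Δ (mult P) (f ∘ π₂) y
    bound y with combine-surjective {n G} {n H} y
    ... | u , v , refl = ℤ.≤-trans (ℤ.+≤+ (δ-≤ (combine-injectiveʳ u₀ v₀ u v)))
      (ℤ.≤-trans (le v) (ℤ.≤-reflexive (sym (cong₂ ℤ._-_ (cong D (π₂-combine u v)) (Δ≡ u v)))))

  deg-π₁ : ∀ D {g} → sumℤ D ≡ + g → sumℤ (D ∘ π₁) ≡ + (n H * g)
  deg-π₁ D {g} deg≡ = begin
    sumℤ (D ∘ π₁)                                                ≡⟨ sumℤ-combine (n G) (D ∘ π₁) ⟩
    sumℤ {n G} (λ u → sumℤ {n H} (λ v → D (π₁ (combine u v))))   ≡⟨ sumℤ-cong (λ u → sumℤ-cong (λ v → cong D (π₁-combine u v))) ⟩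
    sumℤ {n G} (λ u → sumℤ {n H} (λ _ → D u))                    ≡⟨ sumℤ-swap (λ u (_ : Fin (n H)) → D u) ⟩
    sumℤ {n H} (λ _ → sumℤ D)                                    ≡⟨ sumℤ-cong {n H} (λ _ → deg≡) ⟩
    sumℤ {n H} (λ _ → + g)                                       ≡⟨ sumℤ-const (n H) g ⟩
    + (n H * g)                                                  ∎
    where open ≡-Reasoning

  deg-π₂ : ∀ D {g} → sumℤ D ≡ + g → sumℤ (D ∘ π₂) ≡ + (n G * g)
  deg-π₂ D {g} deg≡ = begin
    sumℤ (D ∘ π₂)                                                ≡⟨ sumℤ-combine (n G) (D ∘ π₂) ⟩
    sumℤ {n G} (λ u → sumℤ {n H} (λ v → D (π₂ (combine u v))))   ≡⟨ sumℤ-cong (λ u → sumℤ-cong (λ v → cong D (π₂-combine u v))) ⟩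
    sumℤ {n G} (λ _ → sumℤ D)                                    ≡⟨ sumℤ-cong {n G} (λ _ → deg≡) ⟩
    sumℤ {n G} (λ _ → + g)                                       ≡⟨ sumℤ-const (n G) g ⟩
    + (n G * g)                                                  ∎
    where open ≡-Reasoning

  -- The scramble of rows

  row : Fin (n H) → Subset (n P)
  row v = tabulate (λ x → ⌊ π₂ x ≟ v ⌋)

  combine∈row : ∀ u v → combine u v ∈ row v
  combine∈row u v = ∈-comprehension⁺ (trans (cong (λ w → ⌊ w ≟ v ⌋) (π₂-combine u v)) eq)
    where
    eq : ⌊ v ≟ v ⌋ ≡ true
    eq with v ≟ v
    ... | yes _ = refl
    ... | no v≢v = contradiction refl v≢v

  row⇒combine : ∀ {v x} → x ∈ row v → ∃ λ u → combine u v ≡ x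
  row⇒combine {v} {x} x∈ with combine-surjective {n G} {n H} x
  ... | u , v′ , refl with trans (sym (cong (λ w → ⌊ w ≟ v ⌋) (π₂-combine u v′))) (∈-comprehension⁻ {χ = λ x → ⌊ π₂ x ≟ v ⌋} x∈)
  ...   | eq with v′ ≟ v
  ...     | yes refl = u , refl
  ...     | no _ with () ← eq

  reach-row : ∀ {u u′} v → ReachIn G ⊤ u u′ → ReachIn P (row v) (combine u v) (combine u′ v)
  reach-row v (here {u} _) = here (combine∈row u v)
  reach-row v (step {u} {w} _ 0<uw r) = step (combine∈row u v)
    (subst (0 <_) (sym (trans (mult-□ u v w v) (cong (λ d → δ u w * mult H v v + d * mult G u w) (δ-refl v))))
      (ℕ.<-≤-trans 0<uw (ℕ.≤-trans (ℕ.≤-reflexive (sym (ℕ.*-identityˡ _))) (ℕ.m≤n+m (1 * mult G u w) (δ u w * mult H v v)))))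
    (reach-row v r)

  module _ (connG : Connected G) where

    private
      u₀ : Fin (n G)
      u₀ = fromℕ< (proj₁ connG)

    rows : Scramble P
    rows = List.tabulate row , λ E E∈ → row-connected (∈-tabulate⁻ E∈)
      where
      row-connected : ∀ {E} → ∃ (λ v → E ≡ row v) → InducesConnected P E
      row-connected (v , refl) = (combine u₀ v , combine∈row u₀ v) , reach
        where
        reach : ∀ x y → x ∈ row v → y ∈ row v → ReachIn P (row v) x y
        reach x y x∈ y∈ with row⇒combine x∈ | row⇒combine y∈
        ... | u , refl | u′ , refl = reach-row v (proj₂ connG u u′)

    hitting-rows : ∀ T → Hitting rows T → n H ≤ ∣ T ∣
    hitting-rows T hit = begin
      n H                                                             ≡⟨ ℕ.*-identityʳ (n H) ⟨
      n H * 1                                                         ≡⟨ sumℕ-const (n H) 1 ⟨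
      sumℕ {n H} (λ _ → 1)                                            ≤⟨ sumℕ-mono row-hit ⟩
      sumℕ (λ v → sumℕ (λ u → ι (lookup T (pair u v))))            ≡⟨ sumℕ-swap (λ u v → ι (lookup T (pair u v))) ⟨
      sumℕ (λ u → sumℕ (λ v → ι (lookup T (pair u v))))            ≡⟨ sumℕ-combine (n G) {n H} (ι ∘ lookup T) ⟨
      sumℕ (ι ∘ lookup T)                                             ≡⟨ ∣tabulate∣ (lookup T) ⟨
      ∣ tabulate (lookup T) ∣                                         ≡⟨ cong ∣_∣ (tabulate∘lookup T) ⟩
      ∣ T ∣                                                           ∎
      where
      open ℕ.≤-Reasoning
      row-hit : ∀ v → 1 ≤ sumℕ (λ u → ι (lookup T (pair u v)))
      row-hit v with hit (row v) (∈-tabulate⁺ v)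
      ... | x , x∈row , x∈T with row⇒combine x∈row
      ...   | u , refl = subst (_≤ sumℕ (λ u → ι (lookup T (pair u v)))) (cong ι ([]=⇒lookup x∈T))
                (term≤sumℕ (λ u → ι (lookup T (pair u v))) u)

    column : Subset (n P) → Fin (n G) → Subset (n H)
    column A u = tabulate (λ v → lookup A (combine u v))

    -- Each column crosses the row contained in `A` and the row disjoint from it.
    separating⇒column : ∀ A → Separating rows A → ∀ u → Nonempty (column A u) × Nonempty (∁ (column A u))
    separating⇒column A ((_ , R∈ , R⊆A) , (_ , R′∈ , R′⊆∁A)) u with ∈-tabulate⁻ R∈ | ∈-tabulate⁻ R′∈
    ... | v , refl | v′ , refl =
      (v , ∈-comprehension⁺ ([]=⇒lookup (R⊆A (combine∈row u v)))) ,
      (v′ , x∉p⇒x∈∁p (λ v′∈ → x∈∁p⇒x∉p (R′⊆∁A (combine∈row u v′)) (lookup⇒[]= _ A (∈-comprehension⁻ {χ = λ v → lookup A (combine u v)} v′∈))))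

    columns≤cut : ∀ A → sumℕ (λ u → cutSize H (column A u)) ≤ cutSize P A
    columns≤cut A = begin
      sumℕ (λ u → cutSize H (column A u))
        -- Among the edges leaving a vertex only those within its own column are kept, that is, the
        -- summand with first coordinate `u`.
        ≤⟨ sumℕ-mono (λ u → sumℕ-mono (λ v → ℕ.≤-trans (sumℕ-mono (λ v′ → le u v v′))
             (term≤sumℕ (λ u′ → sumℕ (λ v′ → term (pair u v) (pair u′ v′))) u))) ⟩
      sumℕ (λ u → sumℕ (λ v → sumℕ (λ u′ → sumℕ (λ v′ → term (pair u v) (pair u′ v′)))))
        ≡⟨ sumℕ-cong (λ u → sumℕ-cong (λ v → sumℕ-combine (n G) {n H} (term (pair u v)))) ⟨
      sumℕ (λ u → sumℕ (λ v → sumℕ (term (pair u v))))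
        ≡⟨ sumℕ-combine (n G) {n H} (λ x → sumℕ (term x)) ⟨
      cutSize P A ∎
      where
      open ℕ.≤-Reasoning
      term : Fin (n P) → Fin (n P) → ℕ
      term x y = if lookup A x ∧ not (lookup A y) then mult P x y else 0
      if-mono : ∀ b {i j} → i ≤ j → (if b then i else 0) ≤ (if b then j else 0)
      if-mono true  i≤j = i≤j
      if-mono false i≤j = z≤n
      le : ∀ u v v′ → (if lookup (column A u) v ∧ not (lookup (column A u) v′) then mult H v v′ else 0) ≤ term (pair u v) (pair u v′)
      le u v v′ rewrite lookup∘tabulate (λ v → lookup A (pair u v)) v | lookup∘tabulate (λ v → lookup A (pair u v)) v′ =
        if-mono (lookup A (pair u v) ∧ not (lookup A (pair u v′)))
          (subst (mult H v v′ ≤_) (sym (trans (mult-□ u v u v′) (cong (λ d → d * mult H v v′ + δ v v′ * mult G u u) (δ-refl u))))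
            (ℕ.≤-trans (ℕ.≤-reflexive (sym (ℕ.*-identityˡ _))) (ℕ.m≤m+n _ _)))

    separating-rows : ∀ {k} → IsEdgeConnectivity H k → ∀ A → Separating rows A → n G * k ≤ cutSize P A
    separating-rows {k} (_ , k≤cut) A sep = begin
      n G * k                               ≡⟨ sumℕ-const (n G) k ⟨
      sumℕ {n G} (λ _ → k)                  ≤⟨ sumℕ-mono (λ u → k≤cut (column A u) (proj₁ (separating⇒column A sep u)) (proj₂ (separating⇒column A sep u))) ⟩
      sumℕ (λ u → cutSize H (column A u))   ≤⟨ columns≤cut A ⟩
      cutSize P A                           ∎
      where open ℕ.≤-Reasoning

    rows-order-nH : (∀ k → IsEdgeConnectivity H k → n H ≤ k * n G) → OrderAtLeast rows (n H)
    rows-order-nH bound = hitting-rows , λ A sep → separated A sep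
      where
      separated : ∀ A → Separating rows A → n H ≤ cutSize P A
      -- The cut induced on a single column shows that `H` has an edge-connectivity, so the
      -- hypothesis can be instantiated.
      separated A sep with separating⇒column A sep u₀
      ... | ne , ne∁ with edgeConnectivity-exists H (column A u₀) ne ne∁
      ...   | k , isλ = ℕ.≤-trans (bound k isλ) (ℕ.≤-trans (ℕ.≤-reflexive (ℕ.*-comm k (n G))) (separating-rows isλ A sep))

-- Trees

sum≡1⇒δ : (f : Fin m → ℕ) → sumℕ f ≡ 1 → ∀ {p} → 0 < f p → ∀ w → f w ≡ δ p w
sum≡1⇒δ f Σf≡1 {p} 0<fp w with split-δ f p 0<fp
... | f′ , f≡ , Σf≡ = trans (f≡ w) (trans (cong (_+_ (δ p w)) f′w≡0) (ℕ.+-identityʳ _))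
  where
  f′w≡0 : f′ w ≡ 0
  f′w≡0 = ℕ.n≤0⇒n≡0 (ℕ.≤-trans (term≤sumℕ f′ w) (ℕ.≤-reflexive (ℕ.suc-injective (trans (sym Σf≡) Σf≡1))))

module _ (G : Graph) (isG : IsGraph G) where

  private
    V = Fin (n G)

  -- Vertex sets are encoded as 0/1-valued functions to `ℕ`: adding a vertex becomes addition, and
  -- edge counts expand by distributivity.
  degInto : (V → ℕ) → V → ℕ
  degInto a u = sumℕ (λ w → a w * mult G u w)

  -- Twice the number of edges inside the set with indicator function a.
  inner : (V → ℕ) → ℕ
  inner a = sumℕ (λ u → a u * degInto a u)

  missing : (V → ℕ) → ℕ
  missing a = sumℕ (λ w → 1 ∸ a w)

  grow : (V → ℕ) → V → V → ℕ
  grow a y w = δ y w + a w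

  everything : V → ℕ
  everything _ = 1

  inner-everything : inner everything ≡ 2 * numEdges G
  inner-everything = begin
    inner everything
      ≡⟨ sumℕ-cong (λ u → trans (ℕ.*-identityˡ _) (sumℕ-cong (λ v → ℕ.*-identityˡ (mult G u v)))) ⟩
    sumℕ (λ u → sumℕ (λ v → mult G u v))
      ≡⟨ sumℕ-cong (λ u → trans (sumℕ-cong (λ v → split u v)) (sumℕ-+ (up u) (λ v → up v u))) ⟩
    sumℕ (λ u → sumℕ (λ v → up u v) + sumℕ (λ v → up v u))
      ≡⟨ sumℕ-+ (λ u → sumℕ (λ v → up u v)) (λ u → sumℕ (λ v → up v u)) ⟩
    numEdges G + sumℕ (λ u → sumℕ (λ v → up v u))
      ≡⟨ cong (_+_ (numEdges G)) (trans (sym (sumℕ-swap up)) (sym (ℕ.+-identityʳ _))) ⟩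
    2 * numEdges G ∎
    where
    open ≡-Reasoning
    up : V → V → ℕ
    up u v = if toℕ u <ᵇ toℕ v then mult G u v else 0
    <⇒<ᵇ≡true : ∀ {i j} → i < j → (i <ᵇ j) ≡ true
    <⇒<ᵇ≡true {zero}  (s≤s _) = refl
    <⇒<ᵇ≡true {suc i} (s≤s lt@(s≤s _)) = <⇒<ᵇ≡true lt
    ≤⇒<ᵇ≡false : ∀ {i j} → j ≤ i → (i <ᵇ j) ≡ false
    ≤⇒<ᵇ≡false z≤n = refl
    ≤⇒<ᵇ≡false (s≤s le) = ≤⇒<ᵇ≡false le
    split : ∀ u v → mult G u v ≡ up u v + up v u
    split u v with ℕ.<-cmp (toℕ u) (toℕ v)
    ... | tri< u<v _ _ rewrite <⇒<ᵇ≡true u<v | ≤⇒<ᵇ≡false (ℕ.<⇒≤ u<v) = sym (ℕ.+-identityʳ _)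
    ... | tri> _ _ v<u rewrite <⇒<ᵇ≡true v<u | ≤⇒<ᵇ≡false (ℕ.<⇒≤ v<u) = proj₁ isG u v
    ... | tri≈ _ u≡v _ with refl ← toℕ-injective u≡v rewrite ≤⇒<ᵇ≡false (ℕ.≤-refl {toℕ u}) = proj₂ isG u

  degInto-grow : ∀ a y u → degInto (grow a y) u ≡ mult G u y + degInto a u
  degInto-grow a y u = begin
    sumℕ (λ w → (δ y w + a w) * mult G u w)               ≡⟨ sumℕ-cong (λ w → ℕ.*-distribʳ-+ (mult G u w) (δ y w) (a w)) ⟩
    sumℕ (λ w → δ y w * mult G u w + a w * mult G u w)    ≡⟨ sumℕ-+ (λ w → δ y w * mult G u w) (λ w → a w * mult G u w) ⟩
    sumℕ (λ w → δ y w * mult G u w) + degInto a u         ≡⟨ cong (_+ degInto a u) (sumℕ-δ y (mult G u)) ⟩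
    mult G u y + degInto a u                              ∎
    where open ≡-Reasoning

  inner-grow : ∀ a y → inner (grow a y) ≡ inner a + 2 * degInto a y
  inner-grow a y = begin
    sumℕ (λ u → (δ y u + a u) * degInto (grow a y) u)
      ≡⟨ sumℕ-cong (λ u → trans (cong ((δ y u + a u) *_) (degInto-grow a y u)) (expand (δ y u) (a u) (mult G u y) (degInto a u))) ⟩
    sumℕ (λ u → δ y u * (mult G u y + degInto a u) + (a u * mult G u y + a u * degInto a u))
      ≡⟨ sumℕ-+ (λ u → δ y u * (mult G u y + degInto a u)) (λ u → a u * mult G u y + a u * degInto a u) ⟩
    sumℕ (λ u → δ y u * (mult G u y + degInto a u)) + sumℕ (λ u → a u * mult G u y + a u * degInto a u)
      ≡⟨ cong₂ _+_ (trans (sumℕ-δ y (λ u → mult G u y + degInto a u)) (cong (_+ degInto a y) (proj₂ isG y)))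
           (trans (sumℕ-+ (λ u → a u * mult G u y) (λ u → a u * degInto a u))
             (cong (_+ inner a) (sumℕ-cong (λ u → cong (a u *_) (proj₁ isG u y))))) ⟩
    degInto a y + (degInto a y + inner a)
      ≡⟨ rearrange (degInto a y) (inner a) ⟩
    inner a + 2 * degInto a y ∎
    where
    open ≡-Reasoning
    expand : ∀ d x e f → (d + x) * (e + f) ≡ d * (e + f) + (x * e + x * f)
    expand = ℕ-Solver.solve-∀
    rearrange : ∀ d q → d + (d + q) ≡ q + 2 * d
    rearrange = ℕ-Solver.solve-∀

  missing-grow : ∀ a y → a y ≡ 0 → missing a ≡ suc (missing (grow a y))
  missing-grow a y ay≡0 = begin
    sumℕ (λ w → 1 ∸ a w)                       ≡⟨ sumℕ-cong eq ⟩
    sumℕ (λ w → δ y w + (1 ∸ (δ y w + a w)))   ≡⟨ sumℕ-+ (δ y) (λ w → 1 ∸ (δ y w + a w)) ⟩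
    sumℕ (δ y) + missing (grow a y)            ≡⟨ cong (_+ missing (grow a y)) (sumℕ-δ-1 y) ⟩
    suc (missing (grow a y))                   ∎
    where
    open ≡-Reasoning
    eq : ∀ w → 1 ∸ a w ≡ δ y w + (1 ∸ (δ y w + a w))
    eq w with y ≟ w
    ... | no _ = refl
    ... | yes refl rewrite ay≡0 = refl

  grow≤1 : ∀ {a : V → ℕ} {y} → (∀ w → a w ≤ 1) → a y ≡ 0 → ∀ w → grow a y w ≤ 1
  grow≤1 {a} {y} a≤1 ay≡0 w with y ≟ w
  ... | no _ = a≤1 w
  ... | yes refl rewrite ay≡0 = ℕ.≤-refl

  grow-old : ∀ {a : V → ℕ} {y} r → a r ≡ 1 → a y ≡ 0 → grow a y r ≡ 1
  grow-old {a} {y} r ar≡1 ay≡0 = cong₂ _+_ (δ-≢ {i = y} {r} λ { refl → contradiction (trans (sym ar≡1) ay≡0) λ () }) ar≡1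

  ≤1-≢0⇒≡1 : ∀ {x} → x ≤ 1 → x ≢ 0 → x ≡ 1
  ≤1-≢0⇒≡1 x≤1 x≢0 = ℕ.≤-antisym x≤1 (ℕ.n≢0⇒n>0 x≢0)

  -- The walk along the path stops at its first vertex outside the set.
  frontier : ∀ {a : V → ℕ} {S u v} → (∀ w → a w ≤ 1) → ReachIn G S u v → a u ≡ 1 → a v ≡ 0 →
    ∃₂ λ p y → a p ≡ 1 × a y ≡ 0 × 0 < mult G y p
  frontier a≤1 (here _) au≡1 av≡0 = contradiction (trans (sym au≡1) av≡0) λ ()
  frontier {a} a≤1 (step {u} {w} _ 0<uw r) au≡1 av≡0 with a w ℕ.≟ 0
  ... | yes aw≡0 = u , w , au≡1 , aw≡0 , subst (0 <_) (proj₁ isG u w) 0<uw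
  ... | no  aw≢0 = frontier a≤1 r (≤1-≢0⇒≡1 (a≤1 w) aw≢0) av≡0

  full⊎extendable : Connected G → ∀ {a : V → ℕ} r → (∀ w → a w ≤ 1) → a r ≡ 1 →
    (∀ w → a w ≡ 1) ⊎ (∃₂ λ p y → a p ≡ 1 × a y ≡ 0 × 0 < mult G y p)
  full⊎extendable conn {a} r a≤1 ar≡1 with any? (λ w → a w ℕ.≟ 0)
  ... | no  all≢0      = inj₁ (λ w → ≤1-≢0⇒≡1 (a≤1 w) (λ aw≡0 → all≢0 (w , aw≡0)))
  ... | yes (v , av≡0) = inj₂ (frontier a≤1 (proj₂ conn r v) ar≡1 av≡0)

  0<degInto : ∀ {a : V → ℕ} {p y} → a p ≡ 1 → 0 < mult G y p → 0 < a p * mult G y p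
  0<degInto ap≡1 0<yp rewrite ap≡1 = ℕ.≤-trans 0<yp (ℕ.m≤m+n _ 0)

  -- By connectedness some missing vertex can always be attached by an edge, and `inner` counts each
  -- edge twice; hence the factor 2 per missing vertex.
  inner+missing≤ : Connected G → ∀ c a r → (∀ w → a w ≤ 1) → a r ≡ 1 → missing a ≡ c →
    inner a + 2 * c ≤ inner everything
  inner+missing≤ conn c a r a≤1 ar≡1 miss with full⊎extendable conn r a≤1 ar≡1
  inner+missing≤ conn c a r a≤1 ar≡1 miss | inj₁ a≡1 = ℕ.≤-reflexive (begin
    inner a + 2 * c    ≡⟨ cong (λ c → inner a + 2 * c) (trans (sym miss) (sumℕ-zero (λ w → cong (1 ∸_) (a≡1 w)))) ⟩
    inner a + 0        ≡⟨ ℕ.+-identityʳ _ ⟩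
    inner a            ≡⟨ sumℕ-cong (λ u → cong₂ _*_ (a≡1 u) (sumℕ-cong (λ w → cong (_* mult G u w) (a≡1 w)))) ⟩
    inner everything   ∎)
    where open ≡-Reasoning
  inner+missing≤ conn zero    a r a≤1 ar≡1 miss | inj₂ (p , y , _ , ay≡0 , _) =
    contradiction (trans (sym miss) (missing-grow a y ay≡0)) λ ()
  inner+missing≤ conn (suc c) a r a≤1 ar≡1 miss | inj₂ (p , y , ap≡1 , ay≡0 , 0<yp) = begin
    inner a + 2 * suc c                    ≡⟨ rearrange (inner a) c ⟩
    inner a + 2 * 1 + 2 * c                ≤⟨ ℕ.+-monoˡ-≤ (2 * c) (ℕ.+-monoʳ-≤ (inner a) (ℕ.*-monoʳ-≤ 2
                                                (ℕ.≤-trans (0<degInto {a} ap≡1 0<yp) (term≤sumℕ (λ w → a w * mult G y w) p)))) ⟩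
    inner a + 2 * degInto a y + 2 * c      ≡⟨ cong (_+ 2 * c) (inner-grow a y) ⟨
    inner (grow a y) + 2 * c               ≤⟨ inner+missing≤ conn c (grow a y) r (grow≤1 a≤1 ay≡0) (grow-old {a} r ar≡1 ay≡0)
                                                (ℕ.suc-injective (trans (sym (missing-grow a y ay≡0)) miss)) ⟩
    inner everything                       ∎
    where
    open ℕ.≤-Reasoning
    rearrange : ∀ q c → q + 2 * (1 + c) ≡ q + 2 * 1 + 2 * c
    rearrange = ℕ-Solver.solve-∀

  -- Firing functions on a partly built tree

  Within : (V → ℕ) → V → V → ℕ
  Within a u w = a w * mult G u w

  -- On the subgraph with vertex indicator a, firing according to f moves a chip from r to v.
  Potentials : V → (V → ℕ) → Set
  Potentials r a = ∀ v → a v ≡ 1 → ∃ λ f → ∀ u → a u ≡ 1 → Δ (Within a) f u ≡ + δ r u ℤ.- + δ v u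

  Δ-grow : ∀ a y f u → Δ (Within (grow a y)) f u ≡ + mult G u y ℤ.* (f u ℤ.- f y) ℤ.+ Δ (Within a) f u
  Δ-grow a y f u = begin
    sumℤ (λ w → + ((δ y w + a w) * mult G u w) ℤ.* (f u ℤ.- f w))
      ≡⟨ sumℤ-cong (λ w → expand w) ⟩
    sumℤ (λ w → + δ y w ℤ.* (+ mult G u w ℤ.* (f u ℤ.- f w)) ℤ.+ + Within a u w ℤ.* (f u ℤ.- f w))
      ≡⟨ sumℤ-+ (λ w → + δ y w ℤ.* (+ mult G u w ℤ.* (f u ℤ.- f w))) (λ w → + Within a u w ℤ.* (f u ℤ.- f w)) ⟩
    sumℤ (λ w → + δ y w ℤ.* (+ mult G u w ℤ.* (f u ℤ.- f w))) ℤ.+ Δ (Within a) f u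
      ≡⟨ cong (ℤ._+ Δ (Within a) f u) (sumℤ-δ y (λ w → + mult G u w ℤ.* (f u ℤ.- f w))) ⟩
    + mult G u y ℤ.* (f u ℤ.- f y) ℤ.+ Δ (Within a) f u ∎
    where
    open ≡-Reasoning
    distrib : ∀ d e m x → (d ℤ.* m ℤ.+ e) ℤ.* x ≡ d ℤ.* (m ℤ.* x) ℤ.+ e ℤ.* x
    distrib = solve-∀
    expand : ∀ w → + ((δ y w + a w) * mult G u w) ℤ.* (f u ℤ.- f w) ≡ + δ y w ℤ.* (+ mult G u w ℤ.* (f u ℤ.- f w)) ℤ.+ + Within a u w ℤ.* (f u ℤ.- f w)
    expand w = trans
      (cong (ℤ._* (f u ℤ.- f w)) (trans (cong +_ (ℕ.*-distribʳ-+ (mult G u w) (δ y w) (a w))) (cong (ℤ._+ + Within a u w) (ℤ.pos-* (δ y w) (mult G u w)))))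
      (distrib (+ δ y w) (+ Within a u w) (+ mult G u w) (f u ℤ.- f w))

  module Leaf {a : V → ℕ} {p y} (a≤1 : ∀ w → a w ≤ 1) (ap≡1 : a p ≡ 1) (ay≡0 : a y ≡ 0) (0<yp : 0 < mult G y p)
              (deg≡1 : degInto a y ≡ 1) where

    unique-neighbour : ∀ w → a w * mult G y w ≡ δ p w
    unique-neighbour = sum≡1⇒δ (λ w → a w * mult G y w) deg≡1 (0<degInto {a} ap≡1 0<yp)

    old≢y : ∀ {u} → a u ≡ 1 → y ≢ u
    old≢y au≡1 refl = contradiction (trans (sym au≡1) ay≡0) λ ()

    -- `c` is the number of chips sent from `p` to the leaf `y`. The edge to `p` is the only one
    -- joining `y` to the old part, so every value of `c` can be prescribed without disturbing other
    -- vertices.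
    extend : (V → ℤ) → ℤ → V → ℤ
    extend f c w with y ≟ w
    ... | yes _ = f p ℤ.- c
    ... | no  _ = f w

    extend-y : ∀ f c → extend f c y ≡ f p ℤ.- c
    extend-y f c with y ≟ y
    ... | yes _  = refl
    ... | no y≢y = contradiction refl y≢y

    extend-old : ∀ f c {w} → y ≢ w → extend f c w ≡ f w
    extend-old f c {w} y≢w with y ≟ w
    ... | yes y≡w = contradiction y≡w y≢w
    ... | no  _   = refl

    Δ-extend-y : ∀ f c → Δ (Within (grow a y)) (extend f c) y ≡ ℤ.- c
    Δ-extend-y f c = begin
      Δ (Within (grow a y)) g y                                ≡⟨ Δ-grow a y g y ⟩
      + mult G y y ℤ.* (g y ℤ.- g y) ℤ.+ Δ (Within a) g y      ≡⟨ cong (λ m → + m ℤ.* (g y ℤ.- g y) ℤ.+ Δ (Within a) g y) (proj₂ isG y) ⟩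
      0ℤ ℤ.* (g y ℤ.- g y) ℤ.+ Δ (Within a) g y                ≡⟨ drop (g y ℤ.- g y) (Δ (Within a) g y) ⟩
      Δ (Within a) g y                                         ≡⟨ sumℤ-cong (λ w → cong (λ m → + m ℤ.* (g y ℤ.- g w)) (unique-neighbour w)) ⟩
      sumℤ (λ w → + δ p w ℤ.* (g y ℤ.- g w))                   ≡⟨ sumℤ-δ p (λ w → g y ℤ.- g w) ⟩
      g y ℤ.- g p                                              ≡⟨ cong₂ ℤ._-_ (extend-y f c) (extend-old f c (old≢y ap≡1)) ⟩
      f p ℤ.- c ℤ.- f p                                        ≡⟨ cancel (f p) c ⟩
      ℤ.- c                                                    ∎
      where
      open ≡-Reasoning
      g = extend f c
      drop : ∀ x z → 0ℤ ℤ.* x ℤ.+ z ≡ z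
      drop = solve-∀
      cancel : ∀ x c → x ℤ.- c ℤ.- x ≡ ℤ.- c
      cancel = solve-∀

    Δ-extend-old : ∀ f c u → a u ≡ 1 → Δ (Within (grow a y)) (extend f c) u ≡ + δ p u ℤ.* c ℤ.+ Δ (Within a) f u
    Δ-extend-old f c u au≡1 = trans (Δ-grow a y g u) (cong₂ ℤ._+_ new (sumℤ-cong old))
      where
      g = extend f c
      gu≡fu = extend-old f c (old≢y au≡1)
      cancel : ∀ x c → x ℤ.- (x ℤ.- c) ≡ c
      cancel = solve-∀
      mult≡δ : mult G u y ≡ δ p u
      mult≡δ = begin
        mult G u y         ≡⟨ proj₁ isG u y ⟩
        mult G y u         ≡⟨ ℕ.*-identityˡ _ ⟨
        1 * mult G y u     ≡⟨ cong (_* mult G y u) au≡1 ⟨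
        a u * mult G y u   ≡⟨ unique-neighbour u ⟩
        δ p u              ∎
        where open ≡-Reasoning
      new : + mult G u y ℤ.* (g u ℤ.- g y) ≡ + δ p u ℤ.* c
      new rewrite mult≡δ with p ≟ u
      ... | yes refl = cong (1ℤ ℤ.*_) (trans (cong₂ ℤ._-_ gu≡fu (extend-y f c)) (cancel (f p) c))
      ... | no  _    = trans (ℤ.*-zeroˡ (g u ℤ.- g y)) (sym (ℤ.*-zeroˡ c))
      old : ∀ w → + Within a u w ℤ.* (g u ℤ.- g w) ≡ + Within a u w ℤ.* (f u ℤ.- f w)
      old w = by-cases (y ≟ w)
        where
        vanish : ∀ z → + Within a u y ℤ.* z ≡ 0ℤ
        vanish z = trans (cong (λ x → + (x * mult G u y) ℤ.* z) ay≡0) (ℤ.*-zeroˡ z)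
        by-cases : Dec (y ≡ w) → + Within a u w ℤ.* (g u ℤ.- g w) ≡ + Within a u w ℤ.* (f u ℤ.- f w)
        by-cases (yes refl) = trans (vanish (g u ℤ.- g y)) (sym (vanish (f u ℤ.- f y)))
        by-cases (no y≢w) = cong (ℤ._*_ (+ Within a u w)) (cong₂ ℤ._-_ gu≡fu (extend-old f c y≢w))

    old⊎y : ∀ {u} → grow a y u ≡ 1 → y ≡ u ⊎ (y ≢ u × a u ≡ 1)
    old⊎y {u} eq with y ≟ u
    ... | yes y≡u = inj₁ y≡u
    ... | no  y≢u = inj₂ (y≢u , eq)

    -- For an old target nothing crosses the new edge, so `c` is 0. For the target `y` the chip is
    -- first brought to `p` and then passed on, so `c` is 1.
    potentials-grow : ∀ {r} → a r ≡ 1 → Potentials r a → Potentials r (grow a y)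
    potentials-grow {r} ar≡1 pot v v∈ with old⊎y v∈
    ... | inj₂ (y≢v , av≡1) with pot v av≡1
    ...   | f , Δf = extend f 0ℤ , at
      where
      at : ∀ u → grow a y u ≡ 1 → Δ (Within (grow a y)) (extend f 0ℤ) u ≡ + δ r u ℤ.- + δ v u
      at u u∈ with old⊎y u∈
      ... | inj₁ refl = trans (Δ-extend-y f 0ℤ) (sym (cong₂ (λ i j → + i ℤ.- + j) (δ-≢ (old≢y ar≡1 ∘ sym)) (δ-≢ (y≢v ∘ sym))))
      ... | inj₂ (_ , au≡1) = trans (Δ-extend-old f 0ℤ u au≡1)
              (trans (cong (ℤ._+ Δ (Within a) f u) (ℤ.*-zeroʳ (+ δ p u))) (trans (ℤ.+-identityˡ _) (Δf u au≡1)))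
    potentials-grow {r} ar≡1 pot .y v∈ | inj₁ refl with pot p ap≡1
    ...   | f , Δf = extend f 1ℤ , at
      where
      cancel : ∀ i j → j ℤ.* 1ℤ ℤ.+ (i ℤ.- j) ≡ i ℤ.- 0ℤ
      cancel = solve-∀
      at : ∀ u → grow a y u ≡ 1 → Δ (Within (grow a y)) (extend f 1ℤ) u ≡ + δ r u ℤ.- + δ y u
      at u u∈ with old⊎y u∈
      ... | inj₁ refl = trans (Δ-extend-y f 1ℤ) (sym (cong₂ (λ i j → + i ℤ.- + j) (δ-≢ (old≢y ar≡1 ∘ sym)) (δ-refl y)))
      ... | inj₂ (y≢u , au≡1) = trans (Δ-extend-old f 1ℤ u au≡1)
              (trans (cong (ℤ._+_ (+ δ p u ℤ.* 1ℤ)) (Δf u au≡1))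
                (trans (cancel (+ δ r u) (+ δ p u)) (cong (λ i → + δ r u ℤ.- + i) (sym (δ-≢ y≢u)))))

  module _ (conn : Connected G) where

    -- Build up the vertex set one vertex at a time.  By inner+missing≤ every later vertex contributes
    -- at least one edge, so |E| = |V| - 1 forces each new vertex y to be a leaf of the part built so far.
    grow-to-everything : ∀ c a r → (∀ w → a w ≤ 1) → a r ≡ 1 → missing a ≡ c → inner a + 2 * c ≡ inner everything →
      Potentials r a → Potentials r everything
    grow-to-everything c a r a≤1 ar≡1 miss tight pot with full⊎extendable conn r a≤1 ar≡1
    grow-to-everything c a r a≤1 ar≡1 miss tight pot | inj₁ a≡1 = λ v _ → let f , Δf = pot v (a≡1 v) in
      f , λ u _ → trans (sumℤ-cong (λ w → cong (λ x → + (x * mult G u w) ℤ.* (f u ℤ.- f w)) (sym (a≡1 w)))) (Δf u (a≡1 u))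
    grow-to-everything zero    a r a≤1 ar≡1 miss tight pot | inj₂ (p , y , _ , ay≡0 , _) =
      contradiction (trans (sym miss) (missing-grow a y ay≡0)) λ ()
    grow-to-everything (suc c) a r a≤1 ar≡1 miss tight pot | inj₂ (p , y , ap≡1 , ay≡0 , 0<yp) =
      grow-to-everything c (grow a y) r (grow≤1 a≤1 ay≡0) (grow-old {a} r ar≡1 ay≡0) miss′
        (trans (cong (_+ 2 * c) (inner-grow a y)) (trans (cong (λ d → inner a + 2 * d + 2 * c) deg≡1) (trans (rearrange (inner a) c) tight)))
        (Leaf.potentials-grow a≤1 ap≡1 ay≡0 0<yp deg≡1 ar≡1 pot)
      where
      rearrange : ∀ q c → q + 2 * 1 + 2 * c ≡ q + 2 * (1 + c)
      rearrange = ℕ-Solver.solve-∀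
      miss′ : missing (grow a y) ≡ c
      miss′ = ℕ.suc-injective (trans (sym (missing-grow a y ay≡0)) miss)
      doubled : 2 * degInto a y ≤ 2 * 1
      doubled = ℕ.+-cancelˡ-≤ (inner a) _ _ (ℕ.+-cancelʳ-≤ (2 * c) _ _ (begin
        inner a + 2 * degInto a y + 2 * c    ≡⟨ cong (_+ 2 * c) (inner-grow a y) ⟨
        inner (grow a y) + 2 * c             ≤⟨ inner+missing≤ conn c (grow a y) r (grow≤1 a≤1 ay≡0) (grow-old {a} r ar≡1 ay≡0) miss′ ⟩
        inner everything                     ≡⟨ tight ⟨
        inner a + 2 * suc c                  ≡⟨ rearrange (inner a) c ⟨
        inner a + 2 * 1 + 2 * c              ∎))
        where open ℕ.≤-Reasoning
      deg≡1 : degInto a y ≡ 1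
      deg≡1 = ℕ.≤-antisym (ℕ.*-cancelˡ-≤ 2 doubled) (ℕ.≤-trans (0<degInto {a} ap≡1 0<yp) (term≤sumℕ (λ w → a w * mult G y w) p))

  tree-potentials : IsTree G → ∀ r → Potentials r everything
  tree-potentials (conn , edges) r =
    grow-to-everything conn (missing a₀) a₀ r (grow≤1 (λ _ → z≤n) refl) (trans (ℕ.+-identityʳ _) (δ-refl r)) refl tight pot
    where
    open ≡-Reasoning
    -- The start is the single vertex `r`, with no inner edges and `n G ∸ 1` vertices missing;
    -- equality in `inner+missing≤` is then exactly the edge count of a tree.
    a₀ = grow (λ _ → 0) r
    missing≡ : n G ≡ suc (missing a₀)
    missing≡ = trans (sym (trans (sumℕ-const (n G) 1) (ℕ.*-identityʳ _))) (missing-grow (λ _ → 0) r refl)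
    tight : inner a₀ + 2 * missing a₀ ≡ inner everything
    tight = begin
      inner a₀ + 2 * missing a₀   ≡⟨ cong (_+ 2 * missing a₀) (trans (inner-grow (λ _ → 0) r) (cong₂ (λ i j → i + 2 * j) (sumℕ-zero {n G} (λ _ → refl)) (sumℕ-zero {n G} (λ _ → refl)))) ⟩
      2 * missing a₀              ≡⟨ cong (λ k → 2 * (k ∸ 1)) missing≡ ⟨
      2 * (n G ∸ 1)               ≡⟨ cong (2 *_) edges ⟨
      2 * numEdges G              ≡⟨ inner-everything ⟨
      inner everything            ∎
    pot : Potentials r a₀
    pot v v∈ with r ≟ v
    ... | yes refl = (λ _ → 0ℤ) , λ u _ → trans (Δ-zero (Within a₀) u) (sym (ℤ.+-inverseʳ (+ δ r u)))

  -- A tree has a positive-rank divisor of degree one, with its chip at any chosen vertex.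
  tree-movable : IsTree G → ∀ r v → Movable G (λ u → + δ r u) v
  tree-movable tree r v with tree-potentials tree r v refl
  ... | f , Δf = f , λ u → ℤ.≤-reflexive (begin
    + δ v u                                  ≡⟨ cancel (+ δ r u) (+ δ v u) ⟩
    + δ r u ℤ.- (+ δ r u ℤ.- + δ v u)        ≡⟨ cong (ℤ._-_ (+ δ r u)) (Δf u refl) ⟨
    + δ r u ℤ.- Δ (Within everything) f u    ≡⟨ cong (ℤ._-_ (+ δ r u)) (sumℤ-cong (λ w → cong (λ m → + m ℤ.* (f u ℤ.- f w)) (ℕ.*-identityˡ (mult G u w)))) ⟩
    + δ r u ℤ.- Δ (mult G) f u               ∎)
    where
    open ≡-Reasoning
    cancel : ∀ i j → j ≡ i ℤ.- (i ℤ.- j)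
    cancel = solve-∀

-- Matching the row scramble with the pulled-back divisors

theorem5p1 : (G H : Graph) → IsGraph G → IsGraph H → Connected G → Connected H →
    (IsTree G → (∀ k → IsEdgeConnectivity H k → n H ≤ k * n G) →
    IsScrambleNumber (G □ H) (n H) × IsGonality (G □ H) (n H))
    × (∀ k g → IsGonality H g → IsEdgeConnectivity H k → g ≡ k → n G * k ≤ n H →
    IsScrambleNumber (G □ H) (n G * k) × IsGonality (G □ H) (n G * k))
theorem5p1 G H isG isH connG connH = tree-case , gonality-case
  where
  P = G □ H
  isP = □-isGraph G H isG isH
  u₀ : Fin (n G)
  u₀ = fromℕ< (proj₁ connG)
  x₀ : Fin (n P)
  x₀ = combine u₀ (fromℕ< (proj₁ connH))
  eggs = rows G H isG isH connG

  tree-case : IsTree G → (∀ k → IsEdgeConnectivity H k → n H ≤ k * n G) →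
    IsScrambleNumber P (n H) × IsGonality P (n H)
  tree-case tree bound = scramble+divisor⇒sn≡gon P isP x₀ (n H)
    (eggs , rows-order-nH G H isG isH connG bound)
    -- One chip on each vertex of the copy of `H` over `u₀`.
    (D ∘ quotient {n G} (n H) ,
     Movable⇒PositiveRank P isP (movable-π₁ G H isG isH {D} (tree-movable G isG tree u₀)) ,
     trans (deg-π₁ G H isG isH D degD) (cong +_ (ℕ.*-identityʳ (n H))))
    where
    D : Divisor G
    D u = + δ u₀ u
    degD : sumℤ D ≡ + 1
    degD = trans (sym (+-sumℕ (δ u₀))) (cong +_ (sumℕ-δ-1 u₀))

  gonality-case : ∀ k g → IsGonality H g → IsEdgeConnectivity H k → g ≡ k → n G * k ≤ n H →
    IsScrambleNumber P (n G * k) × IsGonality P (n G * k)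
  -- Matching `g` with `k` makes the bounds meet: the pullback has degree `n G` times the gonality
  -- of `H`, the row cuts at least `n G` times its edge-connectivity.
  gonality-case k .k ((D , rank , degD) , _) isλ refl small = scramble+divisor⇒sn≡gon P isP x₀ (n G * k)
    (eggs , (λ T hit → ℕ.≤-trans small (hitting-rows G H isG isH connG T hit)) ,
            separating-rows G H isG isH connG isλ)
    (D ∘ remainder {n G} (n H) ,
     Movable⇒PositiveRank P isP (movable-π₂ G H isG isH {D} (PositiveRank⇒Movable H isH rank)) ,
     deg-π₂ G H isG isH D degD)
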